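{- Let $n\geq 4$. Among all simple strongly connected digraphs on $n$ vertices, $\overrightarrow{K}(n,n-2,1)$ is (up to isomorphism) the unique digraph which achieves the second maximum spectral radius, and this second maximum equals $\frac{n-2+\sqrt{n^2-4}}{2}$. (The maximum spectral radius, $n-1$, is achieved only by the complete digraph on $n$ vertices.)
   Context: Digraphs are finite and simple (no loops, no multiple arcs; opposite arcs allowed). The spectral radius $\rho(D)$ of a digraph $D$ is the spectral radius of its adjacency matrix $A(D)$. The complete digraph on $n$ vertices has all arcs $(i,j)$, $i\neq j$. $\overrightarrow{K}(n,n-2,1)$ is the digraph obtained from the complete digraph on $n$ vertices by deleting a single arc. -}

module Defs where

open import Algebra.Bundles.Raw using (RawMonoid)
import Algebra.Definitions.RawMonoid as RawMonoidDefs
open import Data.Bool.Base using (Bool; false; T; _∧_; not; if_then_else_)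
open import Data.Fin.Base using (Fin; toℕ)
open import Data.Fin.Permutation using (Permutation′; _⟨$⟩ʳ_)
import Data.Fin.Properties as Fin
open import Data.Integer.Base using (+_)
open import Data.Nat.Base as ℕ using (ℕ)
import Data.Nat.Properties as ℕ
open import Data.Product.Base using (Σ; ∃; ∃-syntax; _×_; _,_; proj₁; proj₂)
open import Data.Rational.Base as ℚ using (ℚ; 0ℚ; 1ℚ; ½; ∣_∣)
import Data.Rational.Properties as ℚ
open import Data.List.Base using (_∷_; [])
open import Data.Vec.Functional using (Vector)
open import Level using (0ℓ)
open import Relation.Binary.Construct.Closure.ReflexiveTransitive using (Star)
open import Relation.Binary.PropositionalEquality
  using (_≡_; refl; sym; trans; cong; cong₂; subst; subst₂)
open import Relation.Nullary.Decidable using (does; dec-true; dec⇒maybe)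
open import Relation.Nullary.Negation using (¬_)
open import Tactic.RingSolver using (solve-∀)
open import Tactic.RingSolver.Core.AlmostCommutativeRing
  using (AlmostCommutativeRing; fromCommutativeRing)

private
  variable
    n : ℕ

-- A real number is a Cauchy sequence of rationals; equality of reals is _≃_, not _≡_.
IsCauchy : (ℕ → ℚ) → Set
IsCauchy f = ∀ {ε} → 0ℚ ℚ.< ε →
  ∃[ N ] (∀ {i j} → N ℕ.≤ i → N ℕ.≤ j → ∣ f i ℚ.- f j ∣ ℚ.< ε)

record ℝ : Set where
  constructor mkℝ
  field
    seq    : ℕ → ℚ
    cauchy : IsCauchy seq

open ℝ public

infix 4 _≃_ _<_ _≤_

_≃_ : ℝ → ℝ → Set
x ≃ y = ∀ {ε} → 0ℚ ℚ.< ε →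
  ∃[ N ] (∀ {i} → N ℕ.≤ i → ∣ seq x i ℚ.- seq y i ∣ ℚ.< ε)

_<_ : ℝ → ℝ → Set
x < y = ∃[ ε ] 0ℚ ℚ.< ε ×
  ∃[ N ] (∀ {i} → N ℕ.≤ i → seq x i ℚ.+ ε ℚ.≤ seq y i)

_≤_ : ℝ → ℝ → Set
x ≤ y = ¬ (y < x)

private
  ℚ-ring : AlmostCommutativeRing 0ℓ 0ℓ
  ℚ-ring = fromCommutativeRing ℚ.+-*-commutativeRing (λ p → dec⇒maybe (0ℚ ℚ.≟ p))

  abstract
    half>0 : ∀ {ε} → 0ℚ ℚ.< ε → 0ℚ ℚ.< ½ ℚ.* ε
    half>0 {ε} ε>0 = subst (ℚ._< ½ ℚ.* ε) (ℚ.*-zeroʳ ½) (ℚ.*-monoʳ-<-pos ½ ε>0)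

    halves : ∀ ε → ½ ℚ.* ε ℚ.+ ½ ℚ.* ε ≡ ε
    halves ε = trans (sym (ℚ.*-distribʳ-+ ε ½ ½)) (ℚ.*-identityˡ ε)

    +-cauchy : ∀ f g → IsCauchy f → IsCauchy g → IsCauchy (λ i → f i ℚ.+ g i)
    +-cauchy f g cf cg {ε} ε>0 with cf (half>0 ε>0) | cg (half>0 ε>0)
    ... | M , hM | N , hN = M ℕ.⊔ N , λ {i} {j} p q →
      subst₂ ℚ._<_ refl (halves ε) (ℚ.≤-<-trans
        (subst (ℚ._≤ ∣ f i ℚ.- f j ∣ ℚ.+ ∣ g i ℚ.- g j ∣) (cong ∣_∣ (regroup (f i) (f j) (g i) (g j)))
          (ℚ.∣p+q∣≤∣p∣+∣q∣ (f i ℚ.- f j) (g i ℚ.- g j)))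
        (ℚ.+-mono-<
          (hM (ℕ.m⊔n≤o⇒m≤o M N p) (ℕ.m⊔n≤o⇒m≤o M N q))
          (hN (ℕ.m⊔n≤o⇒n≤o M N p) (ℕ.m⊔n≤o⇒n≤o M N q))))
      where
      regroup : ∀ a b c d → (a ℚ.- b) ℚ.+ (c ℚ.- d) ≡ (a ℚ.+ c) ℚ.- (b ℚ.+ d)
      regroup = solve-∀ ℚ-ring

    const-cauchy : ∀ q → IsCauchy (λ _ → q)
    const-cauchy q {ε} ε>0 = 0 , λ _ _ →
      subst (ℚ._< ε) (cong ∣_∣ (sym (ℚ.+-inverseʳ q))) ε>0

    neg-cauchy : ∀ f → IsCauchy f → IsCauchy (λ i → ℚ.- f i)
    neg-cauchy f cf {ε} ε>0 with cf ε>0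
    ... | N , hN = N , λ {i} {j} p q →
      subst (ℚ._< ε) (trans (sym (ℚ.∣-p∣≡∣p∣ (f i ℚ.- f j))) (cong ∣_∣ (flip (f i) (f j)))) (hN p q)
      where
      flip : ∀ a b → ℚ.- (a ℚ.- b) ≡ (ℚ.- a) ℚ.- (ℚ.- b)
      flip = solve-∀ ℚ-ring

    bounded : ∀ f → IsCauchy f →
      ∃[ B ] 0ℚ ℚ.< B × ∃[ N ] (∀ {i} → N ℕ.≤ i → ∣ f i ∣ ℚ.≤ B)
    bounded f cf with cf {1ℚ} (ℚ.positive⁻¹ 1ℚ)
    ... | N , hN = 1ℚ ℚ.+ ∣ f N ∣
      , ℚ.+-mono-<-≤ (ℚ.positive⁻¹ 1ℚ) (ℚ.0≤∣p∣ (f N))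
      , N
      , λ {i} p → ℚ.≤-trans
          (subst (ℚ._≤ ∣ f i ℚ.- f N ∣ ℚ.+ ∣ f N ∣) (cong ∣_∣ (regroup (f i) (f N)))
            (ℚ.∣p+q∣≤∣p∣+∣q∣ (f i ℚ.- f N) (f N)))
          (ℚ.+-monoˡ-≤ ∣ f N ∣ (ℚ.<⇒≤ (hN p ℕ.≤-refl)))
      where
      regroup : ∀ a b → (a ℚ.- b) ℚ.+ b ≡ a
      regroup = solve-∀ ℚ-ring

    divide : ∀ {B ε} → 0ℚ ℚ.< B → 0ℚ ℚ.< ε → ∃[ δ ] 0ℚ ℚ.< δ × B ℚ.* δ ≡ ε
    divide {B} {ε} B>0 ε>0 = ℚ.1/ B ℚ.* ε
      , subst (ℚ._< ℚ.1/ B ℚ.* ε) (ℚ.*-zeroʳ (ℚ.1/ B)) (ℚ.*-monoʳ-<-pos (ℚ.1/ B) ε>0)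
      , trans (sym (ℚ.*-assoc B (ℚ.1/ B) ε))
          (trans (cong (ℚ._* ε) (ℚ.*-inverseʳ B)) (ℚ.*-identityˡ ε))
      where
      instance
        B-pos : ℚ.Positive B
        B-pos = ℚ.positive B>0
        B-nonZero : ℚ.NonZero B
        B-nonZero = ℚ.pos⇒nonZero B
        1/B-pos : ℚ.Positive (ℚ.1/ B)
        1/B-pos = ℚ.1/pos⇒pos B

    *-bound : ∀ {B δ ε} a b → 0ℚ ℚ.< B → ∣ a ∣ ℚ.≤ B → ∣ b ∣ ℚ.< δ → B ℚ.* δ ≡ ε →
      ∣ a ℚ.* b ∣ ℚ.< ε
    *-bound {B} {δ} a b B>0 a≤B b<δ refl =
      subst (ℚ._< B ℚ.* δ) (sym (ℚ.∣p*q∣≡∣p∣*∣q∣ a b)) (ℚ.≤-<-trans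
        (ℚ.*-monoʳ-≤-nonNeg ∣ b ∣ {{ℚ.nonNegative (ℚ.0≤∣p∣ b)}} a≤B)
        (ℚ.*-monoʳ-<-pos B {{ℚ.positive B>0}} b<δ))

    *-regroup : ∀ a b c d →
      a ℚ.* (c ℚ.- d) ℚ.+ d ℚ.* (a ℚ.- b) ≡ a ℚ.* c ℚ.- b ℚ.* d
    *-regroup = solve-∀ ℚ-ring

    *-close : ∀ {ε ζ η} a b c d → η ℚ.+ ζ ≡ ε →
      ∣ a ℚ.* (c ℚ.- d) ∣ ℚ.< η → ∣ d ℚ.* (a ℚ.- b) ∣ ℚ.< ζ →
      ∣ a ℚ.* c ℚ.- b ℚ.* d ∣ ℚ.< ε
    *-close a b c d refl p q =
      ℚ.≤-<-trans
        (subst (λ t → ∣ t ∣ ℚ.≤ ∣ a ℚ.* (c ℚ.- d) ∣ ℚ.+ ∣ d ℚ.* (a ℚ.- b) ∣)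
          (*-regroup a b c d)
          (ℚ.∣p+q∣≤∣p∣+∣q∣ (a ℚ.* (c ℚ.- d)) (d ℚ.* (a ℚ.- b))))
        (ℚ.+-mono-< p q)

    *-cauchy : ∀ f g → IsCauchy f → IsCauchy g → IsCauchy (λ i → f i ℚ.* g i)
    *-cauchy f g cf cg {ε} ε>0 = go (½ ℚ.* ε) (halves ε) (half>0 ε>0) (bounded f cf) (bounded g cg)
      where
      go : ∀ η → η ℚ.+ η ≡ ε → 0ℚ ℚ.< η →
        (∃[ B ] 0ℚ ℚ.< B × ∃[ N ] (∀ {i} → N ℕ.≤ i → ∣ f i ∣ ℚ.≤ B)) →
        (∃[ C ] 0ℚ ℚ.< C × ∃[ N ] (∀ {i} → N ℕ.≤ i → ∣ g i ∣ ℚ.≤ C)) →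
        ∃[ N ] (∀ {i j} → N ℕ.≤ i → N ℕ.≤ j → ∣ f i ℚ.* g i ℚ.- f j ℚ.* g j ∣ ℚ.< ε)
      go η η+η≡ε η>0 (B , B>0 , K , hK) (C , C>0 , L , hL) =
        (K ℕ.⊔ L) ℕ.⊔ (M ℕ.⊔ N) , λ {i} {j} p q →
          *-close (f i) (f j) (g i) (g j) η+η≡ε
            (*-bound (f i) (g i ℚ.- g j) B>0 (hK (ℕ.m⊔n≤o⇒m≤o K L (left p)))
              (proj₂ close-g (ℕ.m⊔n≤o⇒n≤o M N (right p)) (ℕ.m⊔n≤o⇒n≤o M N (right q)))
              (proj₂ (proj₂ δ)))
            (*-bound (g j) (f i ℚ.- f j) C>0 (hL (ℕ.m⊔n≤o⇒n≤o K L (left q)))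
              (proj₂ close-f (ℕ.m⊔n≤o⇒m≤o M N (right p)) (ℕ.m⊔n≤o⇒m≤o M N (right q)))
              (proj₂ (proj₂ γ)))
        where
        δ : ∃[ d ] 0ℚ ℚ.< d × B ℚ.* d ≡ η
        δ = divide B>0 η>0
        γ : ∃[ d ] 0ℚ ℚ.< d × C ℚ.* d ≡ η
        γ = divide C>0 η>0
        close-f : ∃[ N ] (∀ {i j} → N ℕ.≤ i → N ℕ.≤ j → ∣ f i ℚ.- f j ∣ ℚ.< proj₁ γ)
        close-f = cf (proj₁ (proj₂ γ))
        close-g : ∃[ N ] (∀ {i j} → N ℕ.≤ i → N ℕ.≤ j → ∣ g i ℚ.- g j ∣ ℚ.< proj₁ δ)
        close-g = cg (proj₁ (proj₂ δ))
        M N : ℕ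
        M = proj₁ close-f
        N = proj₁ close-g
        left : ∀ {k} → (K ℕ.⊔ L) ℕ.⊔ (M ℕ.⊔ N) ℕ.≤ k → K ℕ.⊔ L ℕ.≤ k
        left = ℕ.m⊔n≤o⇒m≤o (K ℕ.⊔ L) (M ℕ.⊔ N)
        right : ∀ {k} → (K ℕ.⊔ L) ℕ.⊔ (M ℕ.⊔ N) ℕ.≤ k → M ℕ.⊔ N ℕ.≤ k
        right = ℕ.m⊔n≤o⇒n≤o (K ℕ.⊔ L) (M ℕ.⊔ N)

infixl 6 _+_ _-_
infixl 7 _*_
infix  8 -_

fromℚ : ℚ → ℝ
fromℚ q = mkℝ (λ _ → q) (const-cauchy q)

fromℕ : ℕ → ℝ
fromℕ k = fromℚ (+ k ℚ./ 1)

_+_ : ℝ → ℝ → ℝ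
x + y = mkℝ (λ i → seq x i ℚ.+ seq y i) (+-cauchy (seq x) (seq y) (cauchy x) (cauchy y))

-_ : ℝ → ℝ
- x = mkℝ (λ i → ℚ.- seq x i) (neg-cauchy (seq x) (cauchy x))

_-_ : ℝ → ℝ → ℝ
x - y = x + (- y)

_*_ : ℝ → ℝ → ℝ
x * y = mkℝ (λ i → seq x i ℚ.* seq y i) (*-cauchy (seq x) (seq y) (cauchy x) (cauchy y))

IsSqrt : ℝ → ℝ → Set
IsSqrt a s = fromℕ 0 ≤ s × s * s ≃ a

infix 4 _≃ℂ_
infixl 6 _+ℂ_
infixl 7 _*ℂ_

record ℂ : Set where
  constructor _+i_
  field
    re im : ℝ

open ℂ public

_≃ℂ_ : ℂ → ℂ → Set
z ≃ℂ w = re z ≃ re w × im z ≃ im w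

_+ℂ_ : ℂ → ℂ → ℂ
z +ℂ w = (re z + re w) +i (im z + im w)

_*ℂ_ : ℂ → ℂ → ℂ
z *ℂ w = (re z * re w - im z * im w) +i (re z * im w + im z * re w)

0ℂ 1ℂ : ℂ
0ℂ = fromℕ 0 +i fromℕ 0
1ℂ = fromℕ 1 +i fromℕ 0

HasModulus : ℂ → ℝ → Set
HasModulus z m = IsSqrt (re z * re z + im z * im z) m

+ℂ-0-rawMonoid : RawMonoid 0ℓ 0ℓ
+ℂ-0-rawMonoid = record { Carrier = ℂ ; _≈_ = _≃ℂ_ ; _∙_ = _+ℂ_ ; ε = 0ℂ }

open RawMonoidDefs +ℂ-0-rawMonoid public using () renaming (sum to sumℂ)

Matrix : ℕ → Set
Matrix n = Fin n → Fin n → ℂ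

_·_ : Matrix n → Vector ℂ n → Vector ℂ n
(A · x) i = sumℂ (λ j → A i j *ℂ x j)

IsEigenvalue : Matrix n → ℂ → Set
IsEigenvalue {n} A z = Σ (Vector ℂ n) λ x →
  ¬ (∀ i → x i ≃ℂ 0ℂ) × (∀ i → (A · x) i ≃ℂ z *ℂ x i)

-- A relation rather than a function, since the eigenvalues are not computed;
-- it determines r up to _≃_.
IsSpectralRadius : Matrix n → ℝ → Set
IsSpectralRadius A r =
  (∃[ z ] IsEigenvalue A z × HasModulus z r) ×
  (∀ z m → IsEigenvalue A z → HasModulus z m → m ≤ r)

record Digraph (n : ℕ) : Set where
  field
    arc      : Fin n → Fin n → Bool
    loopless : ∀ i → arc i i ≡ false

open Digraph public

adjacency : Digraph n → Matrix n
adjacency D i j = if arc D i j then 1ℂ else 0ℂ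

HasSpectralRadius : Digraph n → ℝ → Set
HasSpectralRadius D = IsSpectralRadius (adjacency D)

StronglyConnected : Digraph n → Set
StronglyConnected D = ∀ i j → Star (λ u v → T (arc D u v)) i j

infix 4 _≅_

_≅_ : Digraph n → Digraph n → Set
_≅_ {n} D E = Σ (Permutation′ n) λ π →
  ∀ i j → arc D i j ≡ arc E (π ⟨$⟩ʳ i) (π ⟨$⟩ʳ j)

complete : ∀ n → Digraph n
complete n = record
  { arc      = λ i j → not (does (i Fin.≟ j))
  ; loopless = λ i → cong not (dec-true (i Fin.≟ i) refl)
  }

-- The deleted arc is the one from vertex 0 to vertex 1; deleting any other arc
-- of the complete digraph gives an isomorphic digraph.
K[_,n-2,1] : ∀ n → Digraph n
K[ n ,n-2,1] = record
  { arc      = λ i j → arc (complete n) i j ∧ not (does (toℕ i ℕ.≟ 0) ∧ does (toℕ j ℕ.≟ 1))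
  ; loopless = λ i → cong (_∧ not (does (toℕ i ℕ.≟ 0) ∧ does (toℕ i ℕ.≟ 1))) (loopless (complete n) i)
  }

IsMaximum : (ℝ → Set) → ℝ → Set
IsMaximum P m = P m × (∀ x → P x → x ≤ m)

IsSecondMaximum : (ℝ → Set) → ℝ → Set
IsSecondMaximum P s = ∃[ m ] IsMaximum P m × IsMaximum (λ x → P x × ¬ (x ≃ m)) s

SpectralRadii : ℕ → ℝ → Set
SpectralRadii n r = Σ (Digraph n) λ D → StronglyConnected D × HasSpectralRadius D r

-- Up to isomorphism, D is the only strongly connected digraph on its number
-- of vertices with spectral radius r.
IsUniqueWithSpectralRadius : Digraph n → ℝ → Set
IsUniqueWithSpectralRadius {n} D r =
  StronglyConnected D × HasSpectralRadius D r ×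
  (∀ (E : Digraph n) → StronglyConnected E → HasSpectralRadius E r → E ≅ D)

{-# OPTIONS --safe #-}

-- If positive weights v satisfy A v ≤ r v entrywise, then comparing an eigenvector x with v at an
-- index maximising ∣x j∣ / v j shows that every eigenvalue of A has modulus at most r.  Taking
-- v = 1 − γ at the sources of missing arcs and v = 1 elsewhere, suitable γ give the bound n − 1 for
-- every digraph; t − 1 if an arc is missing, where t is the larger root of t² − n t + 1; and a
-- strictly smaller t′ − 1, with t′ = n − 2/(n + 1), if two arcs are missing.  The first two bounds
-- are attained, by the complete digraph and by K(n, n−2, 1), with explicit eigenvectors.
-- Being irrational, t is approached from above by the iteration t ↦ n − 1/t started at n: every
-- iterate t k satisfies t k ² − n t k + 1 ≥ 0, so t k − 1 is itself a rational bound, and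
-- √(n² − 4) = 2 t − n.

module Submission where

open import Data.Bool.Base using (Bool; true; false; T; if_then_else_; _∧_; _∨_; not)
import Data.Bool.Properties as Bool
open import Data.Empty using (⊥-elim)
open import Data.Fin.Base using (Fin; zero; suc; toℕ)
open import Data.Fin.Permutation as Perm
  using (Permutation′; _⟨$⟩ʳ_; _⟨$⟩ˡ_; _∘ₚ_; transpose)
import Data.Fin.Properties as Fin
open import Data.Integer.Base as ℤ using (+[1+_]; -[1+_])
import Data.Integer.Properties as ℤ
open import Data.Nat.Base as ℕ using (ℕ; zero; suc)
import Data.Nat.Properties as ℕ
open import Data.Product.Base using (Σ; ∃-syntax; _×_; _,_; proj₁; proj₂)
open import Data.Rational.Base as ℚ using (ℚ; 0ℚ; 1ℚ; ½; ∣_∣)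
import Data.Rational.Properties as ℚ
open import Algebra.Properties.CommutativeMonoid.Sum ℚ.+-0-commutativeMonoid
  using (sum; sum-cong-≗; ∑-distrib-+)
open import Data.Rational.Unnormalised.Base as ℚᵘ using (mkℚᵘ; *≡*; *≤*)
import Data.Rational.Unnormalised.Properties as ℚᵘ
open import Data.Sum.Base using (_⊎_; inj₁; inj₂; [_,_]′)
open import Data.Unit.Base using (tt)
open import Data.Vec.Functional using (Vector)
open import Function.Base using (_∘_)
open import Level using (0ℓ)
open import Relation.Binary.Construct.Closure.ReflexiveTransitive as Star using (_◅_)
open import Relation.Binary.PropositionalEquality
  using (_≡_; _≢_; refl; sym; trans; cong; cong₂; subst; subst₂)
open import Relation.Nullary.Decidable
  using (does; yes; no; dec⇒maybe; dec-true; dec-false; ¬?; _×-dec_)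
open import Relation.Nullary.Negation using (¬_; contradiction)
open import Tactic.RingSolver using (solve-∀)
open import Tactic.RingSolver.Core.AlmostCommutativeRing
  using (AlmostCommutativeRing; fromCommutativeRing)

-- The comparison at a maximising index cannot be run on the eigenvector itself: its entries are
-- Cauchy sequences, whose order is undecidable. It is run on the rational approximations at one
-- index `k`, and the maximising vertex may change with `k`. There the eigenvalue equation holds
-- only up to a defect that tends to 0, so the estimate has to be quantitative. The room for this
-- comes from the definition of `_≤_` as a negation: refuting `r < m` supplies a rational gap ε
-- between the bound and the modulus, and every entry then has squared modulus at most a constant
-- times defect / ε². Hence all entries tend to 0, against the choice of a nonzero eigenvector. This
-- needs rational weights, which is why the bound for one missing arc is proved at each iterate and
-- passed to the limit only afterwards.

private
  variable
    n : ℕ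

-- The rational operations are opened only here, since Defs reuses their names for the reals.
module RationalEstimates where

  open import Data.Rational.Base hiding (ℚ; 0ℚ; 1ℚ; ½; ∣_∣)

  -- Arithmetic and order of the rationals.

  ℚ-ring : AlmostCommutativeRing 0ℓ 0ℓ
  ℚ-ring = fromCommutativeRing ℚ.+-*-commutativeRing (λ p → dec⇒maybe (0ℚ ℚ.≟ p))

  ι : ℕ → ℚ
  ι k = ℤ.+ k / 1

  ⅓ : ℚ
  ⅓ = ℤ.+ 1 / 3

  opaque
    ι-suc : ∀ k → ι (suc k) ≡ 1ℚ + ι k
    ι-suc k = ℚ.toℚᵘ-injective (ℚᵘ.≃-trans (ℚ.toℚᵘ-fromℚᵘ (mkℚᵘ (ℤ.+ suc k) 0))
      (ℚᵘ.≃-sym (ℚᵘ.≃-trans (ℚ.toℚᵘ-homo-+ 1ℚ (ι k))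
        (ℚᵘ.≃-trans (ℚᵘ.+-congʳ (toℚᵘ 1ℚ) (ℚ.toℚᵘ-fromℚᵘ (mkℚᵘ (ℤ.+ k) 0)))
          (*≡* (trans (ℤ.*-identityʳ _)
            (trans (cong (λ i → ℤ.+ 1 ℤ.+ i) (ℤ.*-identityʳ (ℤ.+ k))) (sym (ℤ.*-identityʳ _)))))))))

    <⇒≱ : ∀ {a b} → a < b → ¬ b ≤ a
    <⇒≱ a<b b≤a = ℚ.<-irrefl refl (ℚ.<-≤-trans a<b b≤a)

    0≤⇒≤ : ∀ {a b} d → 0ℚ ≤ d → d ≡ b - a → a ≤ b
    0≤⇒≤ {a} {b} _ 0≤d refl = subst₂ _≤_ (ℚ.+-identityʳ a) (regroup a b) (ℚ.+-monoʳ-≤ a 0≤d)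
      where
      regroup : ∀ a b → a + (b - a) ≡ b
      regroup = solve-∀ ℚ-ring

    0<⇒< : ∀ {a b} d → 0ℚ < d → d ≡ b - a → a < b
    0<⇒< {a} {b} _ 0<d refl = subst₂ _<_ (ℚ.+-identityʳ a) (regroup a b) (ℚ.+-monoʳ-< a 0<d)
      where
      regroup : ∀ a b → a + (b - a) ≡ b
      regroup = solve-∀ ℚ-ring

    ≤⇒0≤ : ∀ {a b} → a ≤ b → 0ℚ ≤ b - a
    ≤⇒0≤ {a} {b} a≤b = subst (_≤ b - a) (ℚ.+-inverseʳ a) (ℚ.+-monoˡ-≤ (- a) a≤b)

    <⇒0< : ∀ {a b} → a < b → 0ℚ < b - a
    <⇒0< {a} {b} a<b = subst (_< b - a) (ℚ.+-inverseʳ a) (ℚ.+-monoˡ-< (- a) a<b)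

    +-nonNeg : ∀ {a b} → 0ℚ ≤ a → 0ℚ ≤ b → 0ℚ ≤ a + b
    +-nonNeg = ℚ.+-mono-≤

    *-nonNeg : ∀ {a b} → 0ℚ ≤ a → 0ℚ ≤ b → 0ℚ ≤ a * b
    *-nonNeg {a} {b} 0≤a 0≤b =
      subst (_≤ a * b) (ℚ.*-zeroʳ a) (ℚ.*-monoˡ-≤-nonNeg a {{nonNegative 0≤a}} 0≤b)

    *-pos : ∀ {a b} → 0ℚ < a → 0ℚ < b → 0ℚ < a * b
    *-pos {a} {b} 0<a 0<b =
      subst (_< a * b) (ℚ.*-zeroʳ a) (ℚ.*-monoʳ-<-pos a {{positive 0<a}} 0<b)

    *-mono-≤ : ∀ {a b c d} → 0ℚ ≤ c → 0ℚ ≤ b → a ≤ b → c ≤ d → a * c ≤ b * d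
    *-mono-≤ {a} {b} {c} {d} 0≤c 0≤b a≤b c≤d = ℚ.≤-trans
      (ℚ.*-monoʳ-≤-nonNeg c {{nonNegative 0≤c}} a≤b) (ℚ.*-monoˡ-≤-nonNeg b {{nonNegative 0≤b}} c≤d)

    sq-nonNeg : ∀ a → 0ℚ ≤ a * a
    sq-nonNeg a with ℚ.≤-total 0ℚ a
    ... | inj₁ 0≤a = *-nonNeg 0≤a 0≤a
    ... | inj₂ a≤0 = subst (0ℚ ≤_) (square a)
            (*-nonNeg (ℚ.neg-antimono-≤ a≤0) (ℚ.neg-antimono-≤ a≤0))
      where
      square : ∀ a → (- a) * (- a) ≡ a * a
      square = solve-∀ ℚ-ring

    sq-mono-< : ∀ {a b} → 0ℚ ≤ a → a < b → a * a < b * b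
    sq-mono-< {a} {b} 0≤a a<b = ℚ.≤-<-trans
      (ℚ.*-monoˡ-≤-nonNeg a {{nonNegative 0≤a}} (ℚ.<⇒≤ a<b))
      (ℚ.*-monoˡ-<-pos b {{positive (ℚ.≤-<-trans 0≤a a<b)}} a<b)

    sq-cancel-≤ : ∀ {a b} → 0ℚ ≤ b → a * a ≤ b * b → a ≤ b
    sq-cancel-≤ {a} {b} 0≤b aa≤bb with a ℚ.≤? b
    ... | yes a≤b = a≤b
    ... | no  a≰b = contradiction aa≤bb (<⇒≱ (sq-mono-< 0≤b (ℚ.≰⇒> a≰b)))

    ∣∣-sq : ∀ a → ∣ a ∣ * ∣ a ∣ ≡ a * a
    ∣∣-sq a = trans (sym (ℚ.∣p*q∣≡∣p∣*∣q∣ a a)) (ℚ.0≤p⇒∣p∣≡p (sq-nonNeg a))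

    sq-cancel-∣∣< : ∀ {a e} → 0ℚ < e → a * a < e * e → ∣ a ∣ < e
    sq-cancel-∣∣< {a} {e} 0<e aa<ee with ∣ a ∣ ℚ.<? e
    ... | yes p = p
    ... | no ¬p = contradiction
            (subst (e * e ≤_) (∣∣-sq a)
              (*-mono-≤ (ℚ.<⇒≤ 0<e) (ℚ.0≤∣p∣ a) (ℚ.≮⇒≥ ¬p) (ℚ.≮⇒≥ ¬p)))
            (<⇒≱ aa<ee)

    ∣∣<-intro : ∀ {a e} → a < e → - a < e → ∣ a ∣ < e
    ∣∣<-intro {a} a<e -a<e with ℚ.∣p∣≡p∨∣p∣≡-p a
    ... | inj₁ eq = subst (_< _) (sym eq) a<e
    ... | inj₂ eq = subst (_< _) (sym eq) -a<e

    a≤∣a∣ : ∀ a → a ≤ ∣ a ∣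
    a≤∣a∣ a = sq-cancel-≤ (ℚ.0≤∣p∣ a) (ℚ.≤-reflexive (sym (∣∣-sq a)))

    inverse : ∀ {d} → 0ℚ < d → ∃[ e ] 0ℚ < e × d * e ≡ 1ℚ
    inverse {d} 0<d = 1/ d , ℚ.positive⁻¹ (1/ d) , ℚ.*-inverseʳ d
      where
      instance
        d-pos : Positive d
        d-pos = positive 0<d
        d-nonZero : NonZero d
        d-nonZero = ℚ.pos⇒nonZero d
        1/d-pos : Positive (1/ d)
        1/d-pos = ℚ.1/pos⇒pos d

    archimedean : ∀ {ε} → 0ℚ < ε → ∃[ k ] 1ℚ ≤ ι k * ε
    archimedean {mkℚ (ℤ.+ 0) d c} 0<ε = contradiction (positive 0<ε) λ()
    archimedean {mkℚ -[1+ p ] d c} 0<ε = contradiction (positive 0<ε) λ()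
    -- `suc d` is the denominator of `ε`, so the product is the numerator `suc p`.
    archimedean {ε@(mkℚ +[1+ p ] d c)} 0<ε = suc d , ℚ.toℚᵘ-cancel-≤
      (ℚᵘ.≤-respʳ-≃
        (ℚᵘ.≃-sym (ℚᵘ.≃-trans (ℚ.toℚᵘ-homo-* (ι (suc d)) ε)
          (ℚᵘ.*-congʳ (ℚ.toℚᵘ-fromℚᵘ (mkℚᵘ (ℤ.+ suc d) 0)))))
        (*≤* (ℤ.+≤+ (ℕ.≤-trans (ℕ.≤-reflexive (trans (ℕ.*-identityˡ _) (ℕ.+-identityʳ (suc d))))
          (ℕ.≤-trans (ℕ.m≤m*n (suc d) (suc p)) (ℕ.≤-reflexive (sym (ℕ.*-identityʳ _))))))))

    -- Cauchy–Schwarz, squared so that no square root is needed.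
    triangle-sq : ∀ {c U W u w V v} → 0ℚ ≤ c → 0ℚ ≤ V → 0ℚ ≤ v →
      U * U + W * W ≤ c * (V * V) → u * u + w * w ≤ c * (v * v) →
      (U + u) * (U + u) + (W + w) * (W + w) ≤ c * ((V + v) * (V + v))
    triangle-sq {c} {U} {W} {u} {w} {V} {v} 0≤c 0≤V 0≤v hV hv =
      subst₂ _≤_ (expand U W u w) (collect c V v)
        (ℚ.+-mono-≤ (ℚ.+-mono-≤ hV hv) (ℚ.+-mono-≤ inner inner))
      where
      expand : ∀ U W u w → ((U * U + W * W) + (u * u + w * w)) +
        ((U * u + W * w) + (U * u + W * w)) ≡ (U + u) * (U + u) + (W + w) * (W + w)
      expand = solve-∀ ℚ-ring
      collect : ∀ c V v → (c * (V * V) + c * (v * v)) + (c * (V * v) + c * (V * v)) ≡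
        c * ((V + v) * (V + v))
      collect = solve-∀ ℚ-ring
      lagrange : ∀ U W u w → (U * w - W * u) * (U * w - W * u) ≡
        (U * U + W * W) * (u * u + w * w) - (U * u + W * w) * (U * u + W * w)
      lagrange = solve-∀ ℚ-ring
      square : ∀ c V v → (c * (V * V)) * (c * (v * v)) ≡ (c * (V * v)) * (c * (V * v))
      square = solve-∀ ℚ-ring
      inner : U * u + W * w ≤ c * (V * v)
      inner = sq-cancel-≤ (*-nonNeg 0≤c (*-nonNeg 0≤V 0≤v))
        (ℚ.≤-trans (0≤⇒≤ _ (sq-nonNeg (U * w - W * u)) (lagrange U W u w))
          (subst ((U * U + W * W) * (u * u + w * w) ≤_) (square c V v)
            (*-mono-≤ (+-nonNeg (sq-nonNeg u) (sq-nonNeg w))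
              (*-nonNeg 0≤c (sq-nonNeg V)) hV hv)))

  -- Weighted row sums.

  rowSum : (Fin n → Bool) → (Fin n → ℚ) → ℚ
  rowSum a f = sum (λ j → if a j then f j else 0ℚ)

  -- A row is compared with the full sum by adding absent positions one at a time: the vertex
  -- itself, which loops being excluded is never in its own row, and the targets of missing arcs.
  insert : Fin n → (Fin n → Bool) → Fin n → Bool
  insert l a j = a j ∨ does (l Fin.≟ j)

  opaque
    sum-mono : ∀ {f g : Fin n → ℚ} → (∀ j → f j ≤ g j) → sum f ≤ sum g
    sum-mono {zero}  h = ℚ.≤-refl
    sum-mono {suc n} h = ℚ.+-mono-≤ (h zero) (sum-mono (h ∘ suc))

    sum-zero : ∀ {f : Fin n → ℚ} → (∀ j → f j ≡ 0ℚ) → sum f ≡ 0ℚ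
    sum-zero {zero}  h = refl
    sum-zero {suc n} h = cong₂ _+_ (h zero) (sum-zero (h ∘ suc))

    sum-1 : ∀ n → sum {n} (λ _ → 1ℚ) ≡ ι n
    sum-1 zero    = refl
    sum-1 (suc n) = trans (cong (1ℚ +_) (sum-1 n)) (sym (ι-suc n))

    sum-δ : ∀ (l : Fin n) (f : Fin n → ℚ) →
      sum (λ j → if does (l Fin.≟ j) then f j else 0ℚ) ≡ f l
    sum-δ {suc n} zero f =
      trans (cong (f zero +_) (sum-zero {n} {λ _ → 0ℚ} λ _ → refl)) (ℚ.+-identityʳ _)
    sum-δ (suc l) f = trans (ℚ.+-identityˡ _) (sum-δ l (f ∘ suc))

    rowSum-insert : ∀ (l : Fin n) a f → a l ≡ false → rowSum (insert l a) f ≡ rowSum a f + f l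
    rowSum-insert {n} l a f al = trans (sum-cong-≗ split)
      (trans
        (∑-distrib-+ {n} (λ j → if a j then f j else 0ℚ)
          (λ j → if does (l Fin.≟ j) then f j else 0ℚ))
        (cong (rowSum a f +_) (sum-δ l f)))
      where
      split : ∀ j → (if insert l a j then f j else 0ℚ) ≡
        (if a j then f j else 0ℚ) + (if does (l Fin.≟ j) then f j else 0ℚ)
      split j with l Fin.≟ j
      split j | yes refl rewrite al = sym (ℚ.+-identityˡ _)
      split j | no _ with a j
      ... | true  = sym (ℚ.+-identityʳ _)
      ... | false = refl

    insert-false : ∀ {l j} {a : Fin n → Bool} → l ≢ j → a j ≡ false → insert l a j ≡ false
    insert-false {l = l} {j} l≢j aj = cong₂ _∨_ aj (dec-false (l Fin.≟ j) l≢j)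

    rowSum≤sum : ∀ (a : Fin n → Bool) {f} → (∀ j → 0ℚ ≤ f j) → rowSum a f ≤ sum f
    rowSum≤sum a {f} 0≤f = sum-mono bound
      where
      bound : ∀ j → (if a j then f j else 0ℚ) ≤ f j
      bound j with a j
      ... | true  = ℚ.≤-refl
      ... | false = 0≤f j

    rowSum-nonNeg : ∀ (a : Fin n → Bool) {f} → (∀ j → 0ℚ ≤ f j) → 0ℚ ≤ rowSum a f
    rowSum-nonNeg {zero} a 0≤f = ℚ.≤-refl
    rowSum-nonNeg {suc n} a {f} 0≤f = +-nonNeg here (rowSum-nonNeg (a ∘ suc) (0≤f ∘ suc))
      where
      here : 0ℚ ≤ (if a zero then f zero else 0ℚ)
      here with a zero
      ... | true  = 0≤f zero
      ... | false = ℚ.≤-refl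

    rowSum-full : ∀ {a : Fin n → Bool} f → (∀ j → a j ≡ true) → rowSum a f ≡ sum f
    rowSum-full f full = sum-cong-≗ λ j → cong (if_then f j else 0ℚ) (full j)

    -- The triangle inequality for the complex numbers `u j` + i `w j` of modulus at most √c `v j`,
    -- in squared form; `triangle-sq` adds one term of the row at a time.
    row-triangle : ∀ {c} (a : Fin n → Bool) (u w v : Fin n → ℚ) → 0ℚ ≤ c → (∀ j → 0ℚ ≤ v j) →
      (∀ j → u j * u j + w j * w j ≤ c * (v j * v j)) →
      rowSum a u * rowSum a u + rowSum a w * rowSum a w ≤ c * (rowSum a v * rowSum a v)
    row-triangle {zero} {c} a u w v 0≤c 0≤v h = ℚ.≤-reflexive (sym (ℚ.*-zeroʳ c))
    row-triangle {suc n} {c} a u w v 0≤c 0≤v h with a zero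
    ... | true = triangle-sq {c} {u zero} {w zero} 0≤c
      (0≤v zero) (rowSum-nonNeg (a ∘ suc) (0≤v ∘ suc))
      (h zero) (row-triangle (a ∘ suc) (u ∘ suc) (w ∘ suc) (v ∘ suc) 0≤c (0≤v ∘ suc) (h ∘ suc))
    ... | false rewrite ℚ.+-identityˡ (rowSum (a ∘ suc) (u ∘ suc))
                      | ℚ.+-identityˡ (rowSum (a ∘ suc) (w ∘ suc))
                      | ℚ.+-identityˡ (rowSum (a ∘ suc) (v ∘ suc)) =
      row-triangle (a ∘ suc) (u ∘ suc) (w ∘ suc) (v ∘ suc) 0≤c (0≤v ∘ suc) (h ∘ suc)

    argmax : ∀ (f : Fin (suc n) → ℚ) → ∃[ i ] (∀ j → f j ≤ f i)
    argmax {zero} f = zero , λ { zero → ℚ.≤-refl }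
    argmax {suc n} f with argmax (f ∘ suc)
    ... | i , max with ℚ.≤-total (f zero) (f (suc i))
    ...   | inj₁ le = suc i , λ { zero → le ; (suc j) → max j }
    ...   | inj₂ ge = zero , λ { zero → ℚ.≤-refl ; (suc j) → ℚ.≤-trans (max j) ge }

  -- Powers of ½ and a criterion for Cauchy sequences.

  opaque
    0<1 : 0ℚ < 1ℚ
    0<1 = ℚ.positive⁻¹ 1ℚ

    0<½ : 0ℚ < ½
    0<½ = ℚ.positive⁻¹ ½

    ι-nonNeg : ∀ k → 0ℚ ≤ ι k
    ι-nonNeg zero = ℚ.≤-refl
    ι-nonNeg (suc k) = subst (0ℚ ≤_) (sym (ι-suc k)) (+-nonNeg (ℚ.<⇒≤ 0<1) (ι-nonNeg k))

    ι-mono : ∀ {k l} → k ℕ.≤ l → ι k ≤ ι l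
    ι-mono {zero} {l} ℕ.z≤n = ι-nonNeg l
    ι-mono {suc k} {suc l} (ℕ.s≤s k≤l) =
      subst₂ _≤_ (sym (ι-suc k)) (sym (ι-suc l)) (ℚ.+-monoʳ-≤ 1ℚ (ι-mono k≤l))

  ½^ : ℕ → ℚ
  ½^ zero    = 1ℚ
  ½^ (suc k) = ½ * ½^ k

  opaque
    ½^-nonNeg : ∀ k → 0ℚ ≤ ½^ k
    ½^-nonNeg zero    = ℚ.<⇒≤ 0<1
    ½^-nonNeg (suc k) = *-nonNeg (ℚ.<⇒≤ 0<½) (½^-nonNeg k)

    bernoulli : ∀ k → (1ℚ + ι k) * ½^ k ≤ 1ℚ
    bernoulli zero    = ℚ.≤-refl
    bernoulli (suc k) = ℚ.≤-trans
      (0≤⇒≤ _ (*-nonNeg (ι-nonNeg k) (*-nonNeg (ℚ.<⇒≤ 0<½) (½^-nonNeg k)))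
        (trans (regroup (ι k) (½^ k))
          (cong (λ x → (1ℚ + ι k) * ½^ k - (1ℚ + x) * (½ * ½^ k)) (sym (ι-suc k)))))
      (bernoulli k)
      where
      regroup : ∀ x h → x * (½ * h) ≡ (1ℚ + x) * h - (1ℚ + (1ℚ + x)) * (½ * h)
      regroup = solve-∀ ℚ-ring

    ½^-small : ∀ {ε} → 0ℚ < ε → ∃[ k ] ½^ k < ε
    ½^-small {ε} 0<ε with archimedean 0<ε
    ... | k , 1≤kε = k , ℚ.*-cancelˡ-<-nonNeg (1ℚ + ι k) {{nonNegative 0≤1+k}}
      (ℚ.≤-<-trans (bernoulli k) (ℚ.≤-<-trans 1≤kε (0<⇒< ε 0<ε (regroup (ι k) ε))))
      where
      0≤1+k : 0ℚ ≤ 1ℚ + ι k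
      0≤1+k = +-nonNeg (ℚ.<⇒≤ 0<1) (ι-nonNeg k)
      regroup : ∀ x e → e ≡ (1ℚ + x) * e - x * e
      regroup = solve-∀ ℚ-ring

    -- All terms from `K` on lie between `t K - h K` and `t K`, so any two of them differ by at most
    -- `h K`.
    sandwich-cauchy : ∀ (t : ℕ → ℚ) (h : ℕ → ℚ) → (∀ {ε} → 0ℚ < ε → ∃[ k ] h k < ε) →
      (∀ k m → 0ℚ ≤ t k - t (k ℕ.+ m) × t k - t (k ℕ.+ m) ≤ h k) →
      ∀ {ε} → 0ℚ < ε → ∃[ K ] (∀ {i j} → K ℕ.≤ i → K ℕ.≤ j → ∣ t i - t j ∣ < ε)
    sandwich-cauchy t h hs t-close {ε} 0<ε with hs 0<ε
    ... | K , small = K , λ {i} {j} K≤i K≤j → ∣∣<-intro (half K≤i K≤j)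
        (subst (_< ε) (flip (t i) (t j)) (half K≤j K≤i))
      where
      flip : ∀ a b → b - a ≡ - (a - b)
      flip = solve-∀ ℚ-ring
      regroup : ∀ x a b → (x - b) - (x - a) ≡ a - b
      regroup = solve-∀ ℚ-ring
      close : ∀ {i} → K ℕ.≤ i → 0ℚ ≤ t K - t i × t K - t i ≤ h K
      close {i} K≤i = subst (λ m → 0ℚ ≤ t K - t m × t K - t m ≤ h K)
        (ℕ.m+[n∸m]≡n K≤i) (t-close K (i ℕ.∸ K))
      half : ∀ {i j} → K ℕ.≤ i → K ℕ.≤ j → t i - t j < ε
      half {i} {j} K≤i K≤j = ℚ.≤-<-trans
        (subst₂ _≤_ (regroup (t K) (t i) (t j)) (ℚ.+-identityʳ (h K))
          (ℚ.+-mono-≤ (proj₂ (close K≤j)) (ℚ.neg-antimono-≤ (proj₁ (close K≤i)))))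
        small

  -- The iteration converges to the larger root of t² − N t + 1, which is one more than the
  -- spectral radius of the complete digraph on N vertices with one arc deleted.
  module Iteration (N : ℚ) (4≤N : ι 4 ≤ N) where

    opaque
      reciprocal : ∀ {t} → N - 1ℚ ≤ t → ∃[ e ] 0ℚ < e × t * e ≡ 1ℚ
      reciprocal N-1≤t = inverse (ℚ.<-≤-trans
        (ℚ.<-≤-trans (ℚ.positive⁻¹ (ι 4 - 1ℚ)) (ℚ.+-monoˡ-≤ (- 1ℚ) 4≤N)) N-1≤t)

      3≤ : ∀ {t} → N - 1ℚ ≤ t → ι 3 ≤ t
      3≤ N-1≤t = ℚ.≤-trans (ℚ.+-monoˡ-≤ (- 1ℚ) 4≤N) N-1≤t

      recip≤½ : ∀ {t e} → ι 3 ≤ t → 0ℚ < e → t * e ≡ 1ℚ → e ≤ ½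
      recip≤½ {t} {e} 3≤t 0<e te≡1 = 0≤⇒≤ (½ * ((t - ι 2) * e))
        (*-nonNeg (ℚ.<⇒≤ 0<½)
          (*-nonNeg (ℚ.≤-trans (ℚ.<⇒≤ 0<1) (ℚ.+-monoˡ-≤ (- ι 2) 3≤t)) (ℚ.<⇒≤ 0<e)))
        (trans (regroup t e) (cong (λ x → ½ * x - e) te≡1))
        where
        regroup : ∀ t e → ½ * ((t - ι 2) * e) ≡ ½ * (t * e) - e
        regroup = solve-∀ ℚ-ring

      step-bound : ∀ {e} → e ≤ ½ → N - 1ℚ ≤ N - e
      step-bound {e} e≤½ = 0≤⇒≤ ((½ - e) + ½) (+-nonNeg (≤⇒0≤ e≤½) (ℚ.<⇒≤ 0<½)) (regroup N e)
        where
        regroup : ∀ N e → (½ - e) + ½ ≡ (N - e) - (N - 1ℚ)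
        regroup = solve-∀ ℚ-ring

      N-1≤N : N - 1ℚ ≤ N
      N-1≤N = 0≤⇒≤ 1ℚ (ℚ.<⇒≤ 0<1) (regroup N)
        where
        regroup : ∀ N → 1ℚ ≡ N - (N - 1ℚ)
        regroup = solve-∀ ℚ-ring

    opaque
      -- The lower bound travels with the iterate because the next reciprocal needs it.
      approx : ℕ → Σ ℚ λ t → N - 1ℚ ≤ t
      approx zero    = N , N-1≤N
      approx (suc k) = N - proj₁ 1/t
        , step-bound (recip≤½ (3≤ (proj₂ (approx k))) (proj₁ (proj₂ 1/t)) (proj₂ (proj₂ 1/t)))
        where
        1/t : ∃[ e ] 0ℚ < e × proj₁ (approx k) * e ≡ 1ℚ
        1/t = reciprocal (proj₂ (approx k))

      t e : ℕ → ℚ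
      t k = proj₁ (approx k)
      e k = proj₁ (reciprocal (proj₂ (approx k)))

      t-suc : ∀ k → t (suc k) ≡ N - e k
      t-suc k = refl

    opaque
      unfolding t

      N-1≤t : ∀ k → N - 1ℚ ≤ t k
      N-1≤t k = proj₂ (approx k)

      3≤t : ∀ k → ι 3 ≤ t k
      3≤t k = 3≤ (N-1≤t k)

      0<e : ∀ k → 0ℚ < e k
      0<e k = proj₁ (proj₂ (reciprocal (proj₂ (approx k))))

      t*e≡1 : ∀ k → t k * e k ≡ 1ℚ
      t*e≡1 k = proj₂ (proj₂ (reciprocal (proj₂ (approx k))))

      e≤½ : ∀ k → e k ≤ ½
      e≤½ k = recip≤½ (3≤t k) (0<e k) (t*e≡1 k)

      -- The step t ↦ N − 1/t contracts distances by the factor e k * e l ≤ ½.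
      t-step : ∀ k l → t (suc k) - t (suc l) ≡ (t k - t l) * (e k * e l)
      t-step k l = trans (sym (swap N (e k) (e l))) (trans
        (cong₂ (λ x y → x * e l - y * e k) (sym (t*e≡1 k)) (sym (t*e≡1 l)))
        (regroup (t k) (t l) (e k) (e l)))
        where
        swap : ∀ N e f → 1ℚ * f - 1ℚ * e ≡ (N - e) - (N - f)
        swap = solve-∀ ℚ-ring
        regroup : ∀ t s e f → (t * e) * f - (s * f) * e ≡ (t - s) * (e * f)
        regroup = solve-∀ ℚ-ring

      -- Induction on `k`. For `k` = 0 the difference is 0 or `e m`, as `t 0` is `N`; each further
      -- step multiplies it by a factor `e k * e (k + m)` between 0 and ½. Monotonicity and the
      -- Cauchy property come out together.
      t-close : ∀ k m → 0ℚ ≤ t k - t (k ℕ.+ m) × t k - t (k ℕ.+ m) ≤ ½^ k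
      t-close zero zero = subst (0ℚ ≤_) (sym (ℚ.+-inverseʳ N)) ℚ.≤-refl
        , subst (_≤ 1ℚ) (sym (ℚ.+-inverseʳ N)) (ℚ.<⇒≤ 0<1)
      t-close zero (suc m) = subst (0ℚ ≤_) (regroup N (e m)) (ℚ.<⇒≤ (0<e m))
        , subst (_≤ 1ℚ) (regroup N (e m)) (ℚ.≤-trans (e≤½ m) (ℚ.<⇒≤ (0<⇒< {½} {1ℚ} ½ 0<½ refl)))
        where
        regroup : ∀ N e → e ≡ N - (N - e)
        regroup = solve-∀ ℚ-ring
      t-close (suc k) m with t-close k m
      ... | nonNeg , small = subst (0ℚ ≤_) (sym (t-step k (k ℕ.+ m))) (*-nonNeg nonNeg 0≤ee)
        , subst₂ _≤_ (sym (t-step k (k ℕ.+ m))) (ℚ.*-comm (½^ k) ½)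
          (*-mono-≤ 0≤ee (½^-nonNeg k) small ee≤½)
        where
        0≤ee : 0ℚ ≤ e k * e (k ℕ.+ m)
        0≤ee = ℚ.<⇒≤ (*-pos (0<e k) (0<e (k ℕ.+ m)))
        ee≤½ : e k * e (k ℕ.+ m) ≤ ½
        ee≤½ = ℚ.≤-trans (*-mono-≤ (ℚ.<⇒≤ (0<e (k ℕ.+ m))) (ℚ.<⇒≤ 0<½) (e≤½ k) (e≤½ (k ℕ.+ m)))
          (ℚ.<⇒≤ (0<⇒< {½ * ½} {½} (½ * ½) (*-pos 0<½ 0<½) refl))

      t-cauchy : ∀ {ε} → 0ℚ < ε → ∃[ K ] (∀ {i j} → K ℕ.≤ i → K ℕ.≤ j → ∣ t i - t j ∣ < ε)
      t-cauchy = sandwich-cauchy t ½^ ½^-small t-close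

      t-decreasing : ∀ k → t (suc k) ≤ t k
      t-decreasing k = 0≤⇒≤ _ (subst (λ m → 0ℚ ≤ t k - t m) (ℕ.+-comm k 1) (proj₁ (t-close k 1))) refl

      -- Writing 1 as `t k * e k` exposes the difference of consecutive iterates. That difference is
      -- nonnegative and tends to 0, so the limit is a root; both the square root and the
      -- eigenvector of the digraph with one arc deleted are verified through this identity.
      residual : ∀ k → t k * t k - N * t k + 1ℚ ≡ (t k - t (suc k)) * t k
      residual k = trans (cong (λ x → t k * t k - N * t k + x) (sym (t*e≡1 k)))
        (regroup (t k) N (e k))
        where
        regroup : ∀ t N e → t * t - N * t + t * e ≡ (t - (N - e)) * t
        regroup = solve-∀ ℚ-ring

      -- Lightening one vertex by γ = `e k` leaves total weight `N - e k`, which is the next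
      -- iterate.
      deletion₁ : ∀ k → N - e k ≤ t k
      deletion₁ = t-decreasing

    -- The smaller value `t′` for two missing arcs.

    opaque
      private
        0<N+1 : 0ℚ < N + 1ℚ
        0<N+1 = ℚ.<-≤-trans (ℚ.positive⁻¹ (ι 4 + 1ℚ)) (ℚ.+-monoˡ-≤ 1ℚ 4≤N)

        1/[N-1] : ∃[ f ] 0ℚ < f × (N - 1ℚ) * f ≡ 1ℚ
        1/[N-1] = reciprocal ℚ.≤-refl

        1/[N+1] : ∃[ g ] 0ℚ < g × (N + 1ℚ) * g ≡ 1ℚ
        1/[N+1] = inverse 0<N+1

      -- `f` is 1/(N - 1), an upper bound for every `e k`, so that `N - f` lies below all iterates.
      -- `g` is 1/(N + 1).
      f g : ℚ
      f = proj₁ 1/[N-1]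
      g = proj₁ 1/[N+1]

      0<f : 0ℚ < f
      0<f = proj₁ (proj₂ 1/[N-1])

      0<g : 0ℚ < g
      0<g = proj₁ (proj₂ 1/[N+1])

      [N-1]f≡1 : (N - 1ℚ) * f ≡ 1ℚ
      [N-1]f≡1 = proj₂ (proj₂ 1/[N-1])

      [N+1]g≡1 : (N + 1ℚ) * g ≡ 1ℚ
      [N+1]g≡1 = proj₂ (proj₂ 1/[N+1])

      e≤f : ∀ k → e k ≤ f
      e≤f k = subst₂ _≤_ (trans (cong (e k *_) [N-1]f≡1) (ℚ.*-identityʳ (e k)))
        (trans (regroup (e k) (t k) f) (trans (cong (_* f) (t*e≡1 k)) (ℚ.*-identityˡ f)))
        (ℚ.*-monoˡ-≤-nonNeg (e k) {{nonNegative (ℚ.<⇒≤ (0<e k))}}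
          (ℚ.*-monoʳ-≤-nonNeg f {{nonNegative (ℚ.<⇒≤ 0<f)}} (N-1≤t k)))
        where
        regroup : ∀ e t f → e * (t * f) ≡ (t * e) * f
        regroup = solve-∀ ℚ-ring

      -- This is the distance from `t′` up to `N - f`, with both fractions brought to the common
      -- denominator. For N ≥ 4 it is at least `f * g`, a margin independent of the iterate, as
      -- strict inequality of reals requires.
      gap : (g + g) - f ≡ (N - ι 3) * (f * g)
      gap = trans (unit f g) (trans
        (cong₂ (λ x y → (x * g + x * g) - y * f) (sym [N-1]f≡1) (sym [N+1]g≡1))
        (regroup N f g))
        where
        unit : ∀ f g → (g + g) - f ≡ (1ℚ * g + 1ℚ * g) - 1ℚ * f
        unit = solve-∀ ℚ-ring
        regroup : ∀ N f g → (((N - 1ℚ) * f) * g + ((N - 1ℚ) * f) * g) - ((N + 1ℚ) * g) * f ≡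
          (N - ι 3) * (f * g)
        regroup = solve-∀ ℚ-ring

    -- The lightened weights lose 2/t′ in total when the two arcs share a source and 2/(t′ + 1) when
    -- they do not, and the loss must be at least `N - t′`. Both denominators are at most N + 1, so
    -- the explicit loss 2/(N + 1) serves both cases.
    t′ : ℚ
    t′ = N - (g + g)

    opaque
      unfolding t

      gap-pos : 0ℚ < f * g
      gap-pos = *-pos 0<f 0<g

      N-f≤t : ∀ k → N - f ≤ t k
      N-f≤t zero = 0≤⇒≤ f (ℚ.<⇒≤ 0<f) (regroup N f)
        where
        regroup : ∀ N f → f ≡ N - (N - f)
        regroup = solve-∀ ℚ-ring
      N-f≤t (suc k) = ℚ.+-monoʳ-≤ N (ℚ.neg-antimono-≤ (e≤f k))

      t′+gap≤t : ∀ k → t′ + f * g ≤ t k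
      t′+gap≤t k = ℚ.≤-trans
        (0≤⇒≤ _ (*-nonNeg (≤⇒0≤ 4≤N) (ℚ.<⇒≤ gap-pos))
          (trans (regroup N (f * g)) (trans (cong (_- f * g) (sym gap)) (regroup′ N g f (f * g)))))
        (N-f≤t k)
        where
        regroup : ∀ N d → (N - ι 4) * d ≡ (N - ι 3) * d - d
        regroup = solve-∀ ℚ-ring
        regroup′ : ∀ N g f d → ((g + g) - f) - d ≡ (N - f) - ((N - (g + g)) + d)
        regroup′ = solve-∀ ℚ-ring

      3≤t′ : ι 3 ≤ t′
      3≤t′ = 3≤ (0≤⇒≤ _ (*-nonNeg (ℚ.≤-trans (ℚ.nonNegative⁻¹ (ι 3)) (3≤ ℚ.≤-refl)) (ℚ.<⇒≤ 0<g))
        (trans (regroup N g) (trans (cong (_- (g + g)) [N+1]g≡1) (regroup′ N g))))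
        where
        regroup : ∀ N g → (N - 1ℚ) * g ≡ (N + 1ℚ) * g - (g + g)
        regroup = solve-∀ ℚ-ring
        regroup′ : ∀ N g → 1ℚ - (g + g) ≡ (N - (g + g)) - (N - 1ℚ)
        regroup′ = solve-∀ ℚ-ring

      -- Since `g` inverts N + 1, this turns the known product `s * γ` into a lower bound for γ.
      scaled≤ : ∀ {s γ} → s ≤ N + 1ℚ → 0ℚ ≤ γ → (s * γ) * g ≤ γ
      scaled≤ {s} {γ} s≤N+1 0≤γ = subst₂ _≤_ (sym (ℚ.*-assoc s γ g))
        (trans (regroup (N + 1ℚ) γ g) (trans (cong (γ *_) [N+1]g≡1) (ℚ.*-identityʳ γ)))
        (ℚ.*-monoʳ-≤-nonNeg (γ * g) {{nonNegative (*-nonNeg 0≤γ (ℚ.<⇒≤ 0<g))}} s≤N+1)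
        where
        regroup : ∀ s γ g → s * (γ * g) ≡ γ * (s * g)
        regroup = solve-∀ ℚ-ring

      deletion₂-common : ∀ {γ} → 0ℚ ≤ γ → t′ * γ ≡ ι 2 → N - γ ≤ t′
      deletion₂-common {γ} 0≤γ t′γ≡2 = ℚ.+-monoʳ-≤ N (ℚ.neg-antimono-≤
        (subst (_≤ γ) (trans (cong (_* g) t′γ≡2) (double g)) (scaled≤ t′≤N+1 0≤γ)))
        where
        double : ∀ g → ι 2 * g ≡ g + g
        double = solve-∀ ℚ-ring
        regroup : ∀ N g → 1ℚ + (g + g) ≡ (N + 1ℚ) - (N - (g + g))
        regroup = solve-∀ ℚ-ring
        t′≤N+1 : t′ ≤ N + 1ℚ
        t′≤N+1 = 0≤⇒≤ _ (+-nonNeg (ℚ.<⇒≤ 0<1) (+-nonNeg (ℚ.<⇒≤ 0<g) (ℚ.<⇒≤ 0<g))) (regroup N g)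

      deletion₂-distinct : ∀ {γ} → 0ℚ ≤ γ → (t′ + 1ℚ) * γ ≡ 1ℚ → N - (γ + γ) ≤ t′
      deletion₂-distinct {γ} 0≤γ [t′+1]γ≡1 = ℚ.+-monoʳ-≤ N (ℚ.neg-antimono-≤ (ℚ.+-mono-≤ g≤γ g≤γ))
        where
        regroup : ∀ N g → g + g ≡ (N + 1ℚ) - ((N - (g + g)) + 1ℚ)
        regroup = solve-∀ ℚ-ring
        t′+1≤N+1 : t′ + 1ℚ ≤ N + 1ℚ
        t′+1≤N+1 = 0≤⇒≤ _ (+-nonNeg (ℚ.<⇒≤ 0<g) (ℚ.<⇒≤ 0<g)) (regroup N g)
        g≤γ : g ≤ γ
        g≤γ = subst (_≤ γ) (trans (cong (_* g) [t′+1]γ≡1) (ℚ.*-identityˡ g)) (scaled≤ t′+1≤N+1 0≤γ)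

  -- The weighted comparison for approximate eigenvectors.

  record Weights (n : ℕ) : Set where
    field
      weight inv   : Fin n → ℚ
      weight*inv≡1 : ∀ j → weight j * inv j ≡ 1ℚ
      weight≥0     : ∀ j → 0ℚ ≤ weight j
      weight≤1     : ∀ j → weight j ≤ 1ℚ
      -- Carries an estimate at the maximising vertex over to all the others.
      B            : ℚ
      B>0          : 0ℚ < B
      inv²≤B       : ∀ j → inv j * inv j ≤ B

  opaque
    -- At the vertex `i` where the ratio of modulus to weight is largest, every entry is at most
    -- that ratio times its weight. The triangle inequality and `rows` then bound the squared
    -- modulus of row `i` by r² `q i`, while the defect puts it near m² `q i`; as m ≥ r + ε, `q i`
    -- must be small.
    approximate-eigenvector-small : ∀ {n} (W : Weights (suc n)) → let open Weights W in
      ∀ (a : Fin (suc n) → Fin (suc n) → Bool) {r} → 0ℚ ≤ r →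
      (∀ i → rowSum (a i) weight ≤ r * weight i) →
      ∀ {ε η m} → 0ℚ < ε → r + ε ≤ m → (u w : Fin (suc n) → ℚ) →
      (∀ i → m * m * (u i * u i + w i * w i) -
        (rowSum (a i) u * rowSum (a i) u + rowSum (a i) w * rowSum (a i) w) ≤ η) →
      ∀ j → ε * ε * (u j * u j + w j * w j) ≤ η * B
    approximate-eigenvector-small {n} W a {r} 0≤r rows {ε} {η} {m} 0<ε r+ε≤m u w defect j
      with argmax (λ l → (u l * u l + w l * w l) * (Weights.inv W l * Weights.inv W l))
    ... | i , max = ℚ.≤-trans
        (subst₂ _≤_ refl (sym (ℚ.*-assoc (ε * ε) (q i) B))
          (ℚ.*-monoˡ-≤-nonNeg (ε * ε) {{nonNegative (sq-nonNeg ε)}} q-j≤))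
        (ℚ.*-monoʳ-≤-nonNeg B {{nonNegative (ℚ.<⇒≤ B>0)}} excess≤η)
      where
      open Weights W
      q : Fin (suc n) → ℚ
      q l = u l * u l + w l * w l
      c : ℚ
      c = q i * (inv i * inv i)
      V : ℚ
      V = rowSum (a i) weight
      0≤q : ∀ l → 0ℚ ≤ q l
      0≤q l = +-nonNeg (sq-nonNeg (u l)) (sq-nonNeg (w l))
      0≤c : 0ℚ ≤ c
      0≤c = *-nonNeg (0≤q i) (sq-nonNeg (inv i))
      unscale : ∀ l → q l ≡ (q l * (inv l * inv l)) * (weight l * weight l)
      unscale l = trans (sym (unit (q l))) (trans
        (cong (λ x → q l * (x * x)) (sym (weight*inv≡1 l)))
        (regroup (q l) (weight l) (inv l)))
        where
        unit : ∀ x → x * (1ℚ * 1ℚ) ≡ x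
        unit = solve-∀ ℚ-ring
        regroup : ∀ x v y → x * ((v * y) * (v * y)) ≡ (x * (y * y)) * (v * v)
        regroup = solve-∀ ℚ-ring
      q≤ : ∀ l → q l ≤ c * (weight l * weight l)
      q≤ l = subst (_≤ c * (weight l * weight l)) (sym (unscale l))
        (ℚ.*-monoʳ-≤-nonNeg (weight l * weight l) {{nonNegative (sq-nonNeg (weight l))}} (max l))
      q-j≤ : q j ≤ q i * B
      q-j≤ = ℚ.≤-trans (q≤ j) (ℚ.≤-trans
        (subst (c * (weight j * weight j) ≤_) (ℚ.*-identityʳ c)
          (ℚ.*-monoˡ-≤-nonNeg c {{nonNegative 0≤c}}
            (*-mono-≤ (weight≥0 j) (ℚ.<⇒≤ 0<1) (weight≤1 j) (weight≤1 j))))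
        (ℚ.*-monoˡ-≤-nonNeg (q i) {{nonNegative (0≤q i)}} (inv²≤B i)))
      row : rowSum (a i) u * rowSum (a i) u + rowSum (a i) w * rowSum (a i) w ≤ r * r * q i
      row = ℚ.≤-trans
        (row-triangle (a i) u w weight 0≤c weight≥0 q≤)
        (subst (c * (V * V) ≤_)
          (trans (regroup c r (weight i)) (cong (r * r *_) (sym (unscale i))))
          (ℚ.*-monoˡ-≤-nonNeg c {{nonNegative 0≤c}}
            (*-mono-≤ 0≤V (*-nonNeg 0≤r (weight≥0 i)) (rows i) (rows i))))
        where
        0≤V : 0ℚ ≤ V
        0≤V = rowSum-nonNeg (a i) weight≥0
        regroup : ∀ c r v → c * ((r * v) * (r * v)) ≡ r * r * (c * (v * v))
        regroup = solve-∀ ℚ-ring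
      -- The defect exceeds ε² `q i` by four nonnegative terms: the cross term r ε `q i` of (r + ε)²
      -- twice, the slack of m² over (r + ε)², and the slack in `row`.
      excess≤η : ε * ε * q i ≤ η
      excess≤η = ℚ.≤-trans
        (0≤⇒≤ _
          (+-nonNeg (*-nonNeg (*-nonNeg 0≤r (ℚ.<⇒≤ 0<ε)) (0≤q i))
            (+-nonNeg (*-nonNeg (*-nonNeg 0≤r (ℚ.<⇒≤ 0<ε)) (0≤q i))
              (+-nonNeg (≤⇒0≤ squares) (≤⇒0≤ row))))
          (regroup r ε m (q i) R))
        (defect i)
        where
        R : ℚ
        R = rowSum (a i) u * rowSum (a i) u + rowSum (a i) w * rowSum (a i) w
        0≤r+ε : 0ℚ ≤ r + ε
        0≤r+ε = +-nonNeg 0≤r (ℚ.<⇒≤ 0<ε)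
        squares : (r + ε) * (r + ε) * q i ≤ m * m * q i
        squares = ℚ.*-monoʳ-≤-nonNeg (q i) {{nonNegative (0≤q i)}}
          (*-mono-≤ 0≤r+ε (ℚ.≤-trans 0≤r+ε r+ε≤m) r+ε≤m r+ε≤m)
        regroup : ∀ r e m x R → r * e * x + (r * e * x +
          ((m * m * x - (r + e) * (r + e) * x) + (r * r * x - R))) ≡ (m * m * x - R) - e * e * x
        regroup = solve-∀ ℚ-ring

open RationalEstimates
open import Defs

-- Null sequences and the eigenvalue equation along approximations.

-- `x ≃ y` unfolds to `Null` of the difference sequence, so equations between reals can be proved
-- and used as statements about `Null`.
Null : (ℕ → ℚ) → Set
Null f = ∀ {ε} → 0ℚ ℚ.< ε → ∃[ N ] (∀ {i} → N ℕ.≤ i → ∣ f i ∣ ℚ.< ε)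

opaque
  null-ext : ∀ {f g} → (∀ i → f i ≡ g i) → Null f → Null g
  null-ext f≗g null-f {ε} 0<ε with null-f 0<ε
  ... | N , h = N , λ {i} N≤i → subst (λ x → ∣ x ∣ ℚ.< ε) (f≗g i) (h N≤i)

  null-0 : ∀ {f} → (∀ i → f i ≡ 0ℚ) → Null f
  null-0 f≡0 {ε} 0<ε = 0 , λ {i} _ → subst (λ x → ∣ x ∣ ℚ.< ε) (sym (f≡0 i)) 0<ε

  null-+ : ∀ {f g} → Null f → Null g → Null (λ i → f i ℚ.+ g i)
  null-+ {f} {g} null-f null-g {ε} 0<ε with null-f (*-pos 0<½ 0<ε) | null-g (*-pos 0<½ 0<ε)
  ... | M , hM | N , hN = M ℕ.⊔ N , λ {i} p → ℚ.≤-<-trans (ℚ.∣p+q∣≤∣p∣+∣q∣ (f i) (g i))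
    (subst (∣ f i ∣ ℚ.+ ∣ g i ∣ ℚ.<_) (halves ε)
      (ℚ.+-mono-< (hM (ℕ.m⊔n≤o⇒m≤o M N p)) (hN (ℕ.m⊔n≤o⇒n≤o M N p))))
    where
    halves : ∀ e → ½ ℚ.* e ℚ.+ ½ ℚ.* e ≡ e
    halves = solve-∀ ℚ-ring

  eventually-bounded : ∀ x → ∃[ B ] 0ℚ ℚ.< B × ∃[ N ] (∀ {i} → N ℕ.≤ i → ∣ seq x i ∣ ℚ.≤ B)
  eventually-bounded x with cauchy x 0<1
  ... | N , h = 1ℚ ℚ.+ ∣ seq x N ∣ , ℚ.+-mono-<-≤ 0<1 (ℚ.0≤∣p∣ (seq x N)) , N , λ {i} N≤i →
    ℚ.≤-trans
      (subst (λ y → ∣ y ∣ ℚ.≤ ∣ seq x i ℚ.- seq x N ∣ ℚ.+ ∣ seq x N ∣) (regroup (seq x i) (seq x N))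
        (ℚ.∣p+q∣≤∣p∣+∣q∣ (seq x i ℚ.- seq x N) (seq x N)))
      (ℚ.+-monoˡ-≤ ∣ seq x N ∣ (ℚ.<⇒≤ (h N≤i ℕ.≤-refl)))
    where
    regroup : ∀ a b → (a ℚ.- b) ℚ.+ b ≡ a
    regroup = solve-∀ ℚ-ring

  null-* : ∀ {f} → Null f → ∀ x → Null (λ i → f i ℚ.* seq x i)
  null-* {f} null-f x {ε} 0<ε = M ℕ.⊔ N , λ {i} p → ℚ.≤-<-trans
      (subst (ℚ._≤ ∣ f i ∣ ℚ.* B) (sym (ℚ.∣p*q∣≡∣p∣*∣q∣ (f i) (seq x i)))
        (ℚ.*-monoˡ-≤-nonNeg ∣ f i ∣ {{ℚ.nonNegative (ℚ.0≤∣p∣ (f i))}}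
          (∣x∣≤B (ℕ.m⊔n≤o⇒m≤o M N p))))
      (subst (∣ f i ∣ ℚ.* B ℚ.<_) ε/B*B≡ε
        (ℚ.*-monoˡ-<-pos B {{ℚ.positive 0<B}} (∣f∣<ε/B (ℕ.m⊔n≤o⇒n≤o M N p))))
    where
    B B⁻¹ : ℚ
    B = proj₁ (eventually-bounded x)
    0<B : 0ℚ ℚ.< B
    0<B = proj₁ (proj₂ (eventually-bounded x))
    B⁻¹ = proj₁ (inverse 0<B)
    M N : ℕ
    M = proj₁ (proj₂ (proj₂ (eventually-bounded x)))
    ∣x∣≤B : ∀ {i} → M ℕ.≤ i → ∣ seq x i ∣ ℚ.≤ B
    ∣x∣≤B = proj₂ (proj₂ (proj₂ (eventually-bounded x)))
    late : ∃[ N ] (∀ {i} → N ℕ.≤ i → ∣ f i ∣ ℚ.< ε ℚ.* B⁻¹)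
    late = null-f (*-pos 0<ε (proj₁ (proj₂ (inverse 0<B))))
    N = proj₁ late
    ∣f∣<ε/B : ∀ {i} → N ℕ.≤ i → ∣ f i ∣ ℚ.< ε ℚ.* B⁻¹
    ∣f∣<ε/B = proj₂ late
    regroup : ∀ e b B → e ℚ.* b ℚ.* B ≡ e ℚ.* (B ℚ.* b)
    regroup = solve-∀ ℚ-ring
    ε/B*B≡ε : ε ℚ.* B⁻¹ ℚ.* B ≡ ε
    ε/B*B≡ε = trans (regroup ε B⁻¹ B)
      (trans (cong (ε ℚ.*_) (proj₂ (proj₂ (inverse 0<B)))) (ℚ.*-identityʳ ε))

  eventually-all : ∀ {n} {P : Fin n → ℕ → Set} →
    (∀ i → ∃[ N ] (∀ {k} → N ℕ.≤ k → P i k)) → ∃[ N ] (∀ i {k} → N ℕ.≤ k → P i k)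
  eventually-all {zero} h = 0 , λ ()
  eventually-all {suc n} h with h zero | eventually-all (h ∘ suc)
  ... | M , hM | N , hN = M ℕ.⊔ N , λ
    { zero    p → hM (ℕ.m⊔n≤o⇒m≤o M N p)
    ; (suc i) p → hN i (ℕ.m⊔n≤o⇒n≤o M N p) }

  seq-re-sum : ∀ (f : Vector ℂ n) k → seq (re (sumℂ f)) k ≡ sum (λ j → seq (re (f j)) k)
  seq-re-sum {zero}  f k = refl
  seq-re-sum {suc n} f k = cong (seq (re (f zero)) k ℚ.+_) (seq-re-sum (f ∘ suc) k)

  seq-im-sum : ∀ (f : Vector ℂ n) k → seq (im (sumℂ f)) k ≡ sum (λ j → seq (im (f j)) k)
  seq-im-sum {zero}  f k = refl
  seq-im-sum {suc n} f k = cong (seq (im (f zero)) k ℚ.+_) (seq-im-sum (f ∘ suc) k)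

  seq-re-· : ∀ (D : Digraph n) (x : Vector ℂ n) i k →
    seq (re ((adjacency D · x) i)) k ≡ rowSum (arc D i) (λ j → seq (re (x j)) k)
  seq-re-· D x i k = trans (seq-re-sum (λ j → adjacency D i j *ℂ x j) k) (sum-cong-≗ entry)
    where
    one : ∀ a b → 1ℚ ℚ.* a ℚ.- 0ℚ ℚ.* b ≡ a
    one = solve-∀ ℚ-ring
    nil : ∀ a b → 0ℚ ℚ.* a ℚ.- 0ℚ ℚ.* b ≡ 0ℚ
    nil = solve-∀ ℚ-ring
    entry : ∀ j → seq (re (adjacency D i j *ℂ x j)) k ≡ (if arc D i j then seq (re (x j)) k else 0ℚ)
    entry j with arc D i j
    ... | true  = one (seq (re (x j)) k) (seq (im (x j)) k)
    ... | false = nil (seq (re (x j)) k) (seq (im (x j)) k)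

  seq-im-· : ∀ (D : Digraph n) (x : Vector ℂ n) i k →
    seq (im ((adjacency D · x) i)) k ≡ rowSum (arc D i) (λ j → seq (im (x j)) k)
  seq-im-· D x i k = trans (seq-im-sum (λ j → adjacency D i j *ℂ x j) k) (sum-cong-≗ entry)
    where
    one : ∀ a b → 1ℚ ℚ.* b ℚ.+ 0ℚ ℚ.* a ≡ b
    one = solve-∀ ℚ-ring
    nil : ∀ a b → 0ℚ ℚ.* b ℚ.+ 0ℚ ℚ.* a ≡ 0ℚ
    nil = solve-∀ ℚ-ring
    entry : ∀ j → seq (im (adjacency D i j *ℂ x j)) k ≡ (if arc D i j then seq (im (x j)) k else 0ℚ)
    entry j with arc D i j
    ... | true  = one (seq (re (x j)) k) (seq (im (x j)) k)
    ... | false = nil (seq (re (x j)) k) (seq (im (x j)) k)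

  -- With y = A x, the defect is (m² - ∣z∣²)∣xᵢ∣² + (∣z xᵢ∣² - ∣yᵢ∣²). The second bracket splits
  -- into differences of squares of real and imaginary parts, so every summand is a null sequence
  -- times a Cauchy sequence.
  modulus-defect-null : ∀ (D : Digraph n) {z m} (x : Vector ℂ n) →
    (∀ i → (adjacency D · x) i ≃ℂ z *ℂ x i) → HasModulus z m → ∀ i →
    Null (λ k → let u = λ j → seq (re (x j)) k ; w = λ j → seq (im (x j)) k in
      seq m k ℚ.* seq m k ℚ.* (u i ℚ.* u i ℚ.+ w i ℚ.* w i) ℚ.-
      (rowSum (arc D i) u ℚ.* rowSum (arc D i) u ℚ.+ rowSum (arc D i) w ℚ.* rowSum (arc D i) w))
  modulus-defect-null D {z} {m} x eig (_ , mm≃) i = null-ext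
    (λ k → trans
      (regroup (seq m k) (seq (re z) k) (seq (im z) k) (seq (re (x i)) k) (seq (im (x i)) k)
        (seq Y k) (seq Z k))
      (cong₂ (λ y y′ → seq m k ℚ.* seq m k ℚ.* seq X k ℚ.- (y ℚ.* y ℚ.+ y′ ℚ.* y′))
        (seq-re-· D x i k) (seq-im-· D x i k)))
    (null-+ (null-* mm≃ X)
      (null-+ (null-* (proj₁ (eig i)) (- (Y + re (z *ℂ x i))))
              (null-* (proj₂ (eig i)) (- (Z + im (z *ℂ x i))))))
    where
    X Y Z : ℝ
    X = re (x i) * re (x i) + im (x i) * im (x i)
    Y = re ((adjacency D · x) i)
    Z = im ((adjacency D · x) i)
    regroup : ∀ m a b u w y z →
      (m ℚ.* m ℚ.- (a ℚ.* a ℚ.+ b ℚ.* b)) ℚ.* (u ℚ.* u ℚ.+ w ℚ.* w) ℚ.+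
      ((y ℚ.- (a ℚ.* u ℚ.- b ℚ.* w)) ℚ.* (ℚ.- (y ℚ.+ (a ℚ.* u ℚ.- b ℚ.* w))) ℚ.+
       (z ℚ.- (a ℚ.* w ℚ.+ b ℚ.* u)) ℚ.* (ℚ.- (z ℚ.+ (a ℚ.* w ℚ.+ b ℚ.* u)))) ≡
      m ℚ.* m ℚ.* (u ℚ.* u ℚ.+ w ℚ.* w) ℚ.- (y ℚ.* y ℚ.+ z ℚ.* z)
    regroup = solve-∀ ℚ-ring

  -- A gap ε between `r` and `m` would make every coordinate of the eigenvector a null sequence.
  eigenvalue-modulus-≤ : ∀ (D : Digraph n) (W : Weights n) {r} → 0ℚ ℚ.≤ r →
    (∀ i → rowSum (arc D i) (Weights.weight W) ℚ.≤ r ℚ.* Weights.weight W i) →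
    ∀ z m → IsEigenvalue (adjacency D) z → HasModulus z m → m ≤ fromℚ r
  eigenvalue-modulus-≤ {zero} D W _ _ z m (x , x≄0 , _) _ _ = x≄0 λ ()
  eigenvalue-modulus-≤ {suc n} D W {r} 0≤r rows z m (x , x≄0 , eig) |z|≡m (ε , 0<ε , M , hM) =
    x≄0 λ j → null-ext (λ k → minus0 (seq (re (x j)) k)) (λ {δ} 0<δ → let N , h = small 0<δ in
              N , λ {k} N≤k → sq-cancel-∣∣< 0<δ (ℚ.≤-<-trans
                (0≤⇒≤ _ (sq-nonNeg (seq (im (x j)) k)) (drop₁
                  (seq (re (x j)) k) (seq (im (x j)) k))) (h j N≤k)))
            , null-ext (λ k → minus0 (seq (im (x j)) k)) (λ {δ} 0<δ → let N , h = small 0<δ in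
              N , λ {k} N≤k → sq-cancel-∣∣< 0<δ (ℚ.≤-<-trans
                (0≤⇒≤ _ (sq-nonNeg (seq (re (x j)) k)) (drop₂
                  (seq (re (x j)) k) (seq (im (x j)) k))) (h j N≤k)))
    where
    open Weights W
    q : Fin (suc n) → ℕ → ℚ
    q j k = seq (re (x j)) k ℚ.* seq (re (x j)) k ℚ.+ seq (im (x j)) k ℚ.* seq (im (x j)) k
    minus0 : ∀ a → a ≡ a ℚ.- 0ℚ
    minus0 = solve-∀ ℚ-ring
    drop₁ : ∀ a b → b ℚ.* b ≡ (a ℚ.* a ℚ.+ b ℚ.* b) ℚ.- a ℚ.* a
    drop₁ = solve-∀ ℚ-ring
    drop₂ : ∀ a b → a ℚ.* a ≡ (a ℚ.* a ℚ.+ b ℚ.* b) ℚ.- b ℚ.* b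
    drop₂ = solve-∀ ℚ-ring
    defect : Fin (suc n) → ℕ → ℚ
    defect i k = let u = λ j → seq (re (x j)) k ; w = λ j → seq (im (x j)) k in
      seq m k ℚ.* seq m k ℚ.* (u i ℚ.* u i ℚ.+ w i ℚ.* w i) ℚ.-
      (rowSum (arc D i) u ℚ.* rowSum (arc D i) u ℚ.+ rowSum (arc D i) w ℚ.* rowSum (arc D i) w)
    defect-null : ∀ i → Null (defect i)
    defect-null = modulus-defect-null D {z} {m} x eig |z|≡m
    half : ∀ E → ½ ℚ.* E ≡ E ℚ.- 1ℚ ℚ.* (½ ℚ.* E)
    half = solve-∀ ℚ-ring
    regroup : ∀ B b E → (B ℚ.* b) ℚ.* (½ ℚ.* E) ≡ (½ ℚ.* (E ℚ.* b)) ℚ.* B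
    regroup = solve-∀ ℚ-ring
    small : ∀ {δ} → 0ℚ ℚ.< δ → ∃[ N ] (∀ j {k} → N ℕ.≤ k → q j k ℚ.< δ ℚ.* δ)
    small {δ} 0<δ = M ℕ.⊔ N , bound
      where
      E b η : ℚ
      E = (ε ℚ.* ε) ℚ.* (δ ℚ.* δ)
      b = proj₁ (inverse B>0)
      -- Half of ε²δ²/B, so that `η * B` is strictly below ε²δ².
      η = ½ ℚ.* (E ℚ.* b)
      0<E : 0ℚ ℚ.< E
      0<E = *-pos (*-pos 0<ε 0<ε) (*-pos 0<δ 0<δ)
      0<η : 0ℚ ℚ.< η
      0<η = *-pos 0<½ (*-pos 0<E (proj₁ (proj₂ (inverse B>0))))
      late : ∃[ N ] (∀ i {k} → N ℕ.≤ k → ∣ defect i k ∣ ℚ.< η)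
      late = eventually-all (λ i → defect-null i 0<η)
      N : ℕ
      N = proj₁ late
      ηB<E : η ℚ.* B ℚ.< E
      ηB<E = subst (ℚ._< E)
        (trans (cong (ℚ._* (½ ℚ.* E)) (sym (proj₂ (proj₂ (inverse B>0))))) (regroup B b E))
        (0<⇒< (½ ℚ.* E) (*-pos 0<½ 0<E) (half E))
      scaled : ∀ j {k} → M ℕ.⊔ N ℕ.≤ k → (ε ℚ.* ε) ℚ.* q j k ℚ.≤ η ℚ.* B
      scaled j {k} p = approximate-eigenvector-small W (arc D) {r} 0≤r rows {ε} {η} {seq m k}
        0<ε (hM (ℕ.m⊔n≤o⇒m≤o M N p)) (λ j → seq (re (x j)) k) (λ j → seq (im (x j)) k)
        (λ i → ℚ.<⇒≤ (ℚ.≤-<-trans {defect i k} {∣ defect i k ∣} {η} (a≤∣a∣ (defect i k))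
          (proj₂ late i (ℕ.m⊔n≤o⇒n≤o M N p)))) j
      bound : ∀ j {k} → M ℕ.⊔ N ℕ.≤ k → q j k ℚ.< δ ℚ.* δ
      bound j {k} p = ℚ.*-cancelˡ-<-nonNeg (ε ℚ.* ε) {{ℚ.nonNegative (sq-nonNeg ε)}}
        {q j k} {δ ℚ.* δ} (ℚ.≤-<-trans (scaled j p) ηB<E)

-- Lightened weights and the bounds for missing arcs.

ModuliBoundedBy : Digraph n → ℝ → Set
ModuliBoundedBy D r = ∀ z m → IsEigenvalue (adjacency D) z → HasModulus z m → m ≤ r

lighten : (Fin n → Bool) → ℚ → Fin n → ℚ
lighten P γ j = if P j then 1ℚ ℚ.- γ else 1ℚ

single : Fin n → Fin n → Bool
single p j = does (p Fin.≟ j)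

opaque
  sum-lighten : ∀ (P : Fin n → Bool) γ → sum (lighten P γ) ≡ ι n ℚ.- rowSum P (λ _ → γ)
  sum-lighten {n} P γ = trans (regroup (sum (lighten P γ)) (rowSum P (λ _ → γ)))
    (cong (ℚ._- rowSum P (λ _ → γ))
      (trans (sym (∑-distrib-+ {n} (lighten P γ) (λ j → if P j then γ else 0ℚ)))
        (trans (sum-cong-≗ ones) (sum-1 n))))
    where
    regroup : ∀ a b → a ≡ (a ℚ.+ b) ℚ.- b
    regroup = solve-∀ ℚ-ring
    cancel : ∀ c → (1ℚ ℚ.- c) ℚ.+ c ≡ 1ℚ
    cancel = solve-∀ ℚ-ring
    ones : ∀ j → lighten P γ j ℚ.+ (if P j then γ else 0ℚ) ≡ 1ℚ
    ones j with P j
    ... | true  = cancel γ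
    ... | false = refl

  sum-lighten-single : ∀ (p : Fin n) γ → sum (lighten (single p) γ) ≡ ι n ℚ.- γ
  sum-lighten-single {n} p γ = trans (sum-lighten (single p) γ)
    (cong (λ x → ι n ℚ.- x) (sum-δ p (λ _ → γ)))

  sum-lighten-pair : ∀ {p p′ : Fin n} γ → p ≢ p′ →
    sum (lighten (insert p′ (single p)) γ) ≡ ι n ℚ.- (γ ℚ.+ γ)
  sum-lighten-pair {n} {p} {p′} γ p≢p′ = trans (sum-lighten (insert p′ (single p)) γ)
    (cong (λ x → ι n ℚ.- x)
      (trans (rowSum-insert p′ (single p) (λ _ → γ) (dec-false (p Fin.≟ p′) p≢p′))
        (cong (ℚ._+ γ) (sum-δ p (λ _ → γ)))))

  row-loopless : ∀ (D : Digraph n) {v} → (∀ j → 0ℚ ℚ.≤ v j) → ∀ i →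
    rowSum (arc D i) v ℚ.+ v i ℚ.≤ sum v
  row-loopless D {v} 0≤v i = subst (ℚ._≤ sum v) (rowSum-insert i (arc D i) v (loopless D i))
    (rowSum≤sum (insert i (arc D i)) 0≤v)

  row-missing : ∀ (D : Digraph n) {v} → (∀ j → 0ℚ ℚ.≤ v j) → ∀ {i q} → i ≢ q → arc D i q ≡ false →
    rowSum (arc D i) v ℚ.+ v i ℚ.+ v q ℚ.≤ sum v
  row-missing D {v} 0≤v {i} {q} i≢q iq = subst (ℚ._≤ sum v)
    (trans (rowSum-insert q (insert i (arc D i)) v (insert-false {a = arc D i} i≢q iq))
      (cong (ℚ._+ v q) (rowSum-insert i (arc D i) v (loopless D i))))
    (rowSum≤sum (insert q (insert i (arc D i))) 0≤v)

  row-missing₂ : ∀ (D : Digraph n) {v} → (∀ j → 0ℚ ℚ.≤ v j) → ∀ {i q q′} → i ≢ q → i ≢ q′ → q ≢ q′ →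
    arc D i q ≡ false → arc D i q′ ≡ false →
    rowSum (arc D i) v ℚ.+ v i ℚ.+ v q ℚ.+ v q′ ℚ.≤ sum v
  row-missing₂ {n} D {v} 0≤v {i} {q} {q′} i≢q i≢q′ q≢q′ iq iq′ = subst (ℚ._≤ sum v)
    (trans (rowSum-insert q′ a₂ v
        (insert-false {a = a₁} q≢q′ (insert-false {a = arc D i} i≢q′ iq′)))
      (cong (ℚ._+ v q′)
        (trans (rowSum-insert q a₁ v (insert-false {a = arc D i} i≢q iq))
          (cong (ℚ._+ v q) (rowSum-insert i (arc D i) v (loopless D i))))))
    (rowSum≤sum (insert q′ a₂) 0≤v)
    where
    a₁ a₂ : Fin n → Bool
    a₁ = insert i (arc D i)
    a₂ = insert q a₁

  -- 3γ ≤ tγ ≤ 2 leaves at least ⅓.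
  1-γ>0 : ∀ {t γ} → ι 3 ℚ.≤ t → 0ℚ ℚ.≤ γ → t ℚ.* γ ℚ.≤ ι 2 → 0ℚ ℚ.< 1ℚ ℚ.- γ
  1-γ>0 {t} {γ} 3≤t 0≤γ tγ≤2 = ℚ.<-≤-trans (ℚ.positive⁻¹ ⅓)
    (0≤⇒≤ _ (*-nonNeg (ℚ.<⇒≤ (ℚ.positive⁻¹ ⅓)) (+-nonNeg (≤⇒0≤ tγ≤2) (*-nonNeg (≤⇒0≤ 3≤t) 0≤γ)))
      (regroup t γ))
    where
    regroup : ∀ t γ → ⅓ ℚ.* ((ι 2 ℚ.- t ℚ.* γ) ℚ.+ (t ℚ.- ι 3) ℚ.* γ) ≡ (1ℚ ℚ.- γ) ℚ.- ⅓
    regroup = solve-∀ ℚ-ring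

  lighten-nonNeg : ∀ (P : Fin n → Bool) {γ} → 0ℚ ℚ.< 1ℚ ℚ.- γ → ∀ j → 0ℚ ℚ.≤ lighten P γ j
  lighten-nonNeg P 0<1-γ j with P j
  ... | true  = ℚ.<⇒≤ 0<1-γ
  ... | false = ℚ.<⇒≤ 0<1

lighten-weights : ∀ (P : Fin n → Bool) {γ} → 0ℚ ℚ.≤ γ → 0ℚ ℚ.< 1ℚ ℚ.- γ → Weights n
lighten-weights {n} P {γ} 0≤γ 0<1-γ = record
  { weight       = lighten P γ
  ; inv          = inv
  ; weight*inv≡1 = weight*inv≡1
  ; weight≥0     = lighten-nonNeg P {γ} 0<1-γ
  ; weight≤1     = weight≤1
  -- Each reciprocal is `b` or 1, and this dominates both squares.
  ; B            = 1ℚ ℚ.+ b ℚ.* b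
  ; B>0          = ℚ.+-mono-<-≤ 0<1 (sq-nonNeg b)
  ; inv²≤B       = inv²≤B
  }
  where
  b : ℚ
  b = proj₁ (inverse 0<1-γ)
  inv : Fin n → ℚ
  inv j = if P j then b else 1ℚ
  opaque
    weight*inv≡1 : ∀ j → lighten P γ j ℚ.* inv j ≡ 1ℚ
    weight*inv≡1 j with P j
    ... | true  = proj₂ (proj₂ (inverse 0<1-γ))
    ... | false = refl
    weight≤1 : ∀ j → lighten P γ j ℚ.≤ 1ℚ
    weight≤1 j with P j
    ... | true  = subst (1ℚ ℚ.- γ ℚ.≤_) (ℚ.+-identityʳ 1ℚ) (ℚ.+-monoʳ-≤ 1ℚ (ℚ.neg-antimono-≤ 0≤γ))
    ... | false = ℚ.≤-refl
    inv²≤B : ∀ j → inv j ℚ.* inv j ℚ.≤ 1ℚ ℚ.+ b ℚ.* b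
    inv²≤B j with P j
    ... | true  = 0≤⇒≤ 1ℚ (ℚ.<⇒≤ 0<1) (regroup (b ℚ.* b))
      where
      regroup : ∀ x → 1ℚ ≡ (1ℚ ℚ.+ x) ℚ.- x
      regroup = solve-∀ ℚ-ring
    ... | false = 0≤⇒≤ (b ℚ.* b) (sq-nonNeg b) (regroup (b ℚ.* b))
      where
      regroup : ∀ x → x ≡ (1ℚ ℚ.+ x) ℚ.- 1ℚ ℚ.* 1ℚ
      regroup = solve-∀ ℚ-ring

-- The absent targets of `i`, apart from `i` itself, weigh at least tγ in total. If all weights sum
-- to at most t, this rearranges to a row sum of at most (t - 1)(1 - γ), as needed at a vertex of
-- weight 1 - γ. At a vertex of weight 1 the missing loop alone gives t - 1.
Light : Digraph n → (Fin n → Bool) → ℚ → ℚ → Fin n → Set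
Light D P t γ i = rowSum (arc D i) (lighten P γ) ℚ.+ lighten P γ i ℚ.+ t ℚ.* γ ℚ.≤ sum (lighten P γ)

opaque
  moduli-≤ : ∀ (D : Digraph n) (P : Fin n → Bool) {t γ} →
    ι 3 ℚ.≤ t → 0ℚ ℚ.≤ γ → t ℚ.* γ ℚ.≤ ι 2 → sum (lighten P γ) ℚ.≤ t →
    (∀ i → P i ≡ true → Light D P t γ i) →
    ModuliBoundedBy D (fromℚ (t ℚ.- 1ℚ))
  moduli-≤ {n} D P {t} {γ} 3≤t 0≤γ tγ≤2 sum≤t light = eigenvalue-modulus-≤ D
    (lighten-weights P {γ} 0≤γ 0<1-γ)
    (ℚ.≤-trans (ℚ.nonNegative⁻¹ (ι 3 ℚ.- 1ℚ)) (ℚ.+-monoˡ-≤ (ℚ.- 1ℚ) 3≤t))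
    (λ i → row i (P i) refl)
    where
    0<1-γ : 0ℚ ℚ.< 1ℚ ℚ.- γ
    0<1-γ = 1-γ>0 3≤t 0≤γ tγ≤2
    R : Fin n → ℚ
    R i = rowSum (arc D i) (lighten P γ)
    true-row : ∀ t γ R → t ℚ.- (R ℚ.+ (1ℚ ℚ.- γ) ℚ.+ t ℚ.* γ) ≡ (t ℚ.- 1ℚ) ℚ.* (1ℚ ℚ.- γ) ℚ.- R
    true-row = solve-∀ ℚ-ring
    false-row : ∀ t R → t ℚ.- (R ℚ.+ 1ℚ) ≡ (t ℚ.- 1ℚ) ℚ.* 1ℚ ℚ.- R
    false-row = solve-∀ ℚ-ring
    row : ∀ i b → P i ≡ b → R i ℚ.≤ (t ℚ.- 1ℚ) ℚ.* lighten P γ i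
    row i true Pi = subst (λ x → R i ℚ.≤ (t ℚ.- 1ℚ) ℚ.* x) (sym vi)
      (0≤⇒≤ _ (≤⇒0≤ (ℚ.≤-trans
          (subst (λ x → R i ℚ.+ x ℚ.+ t ℚ.* γ ℚ.≤ sum (lighten P γ)) vi (light i Pi)) sum≤t))
        (true-row t γ (R i)))
      where
      vi : lighten P γ i ≡ 1ℚ ℚ.- γ
      vi = cong (if_then 1ℚ ℚ.- γ else 1ℚ) Pi
    row i false Pi = subst (λ x → R i ℚ.≤ (t ℚ.- 1ℚ) ℚ.* x) (sym vi)
      (0≤⇒≤ _ (≤⇒0≤ (ℚ.≤-trans (subst (λ x → R i ℚ.+ x ℚ.≤ sum (lighten P γ)) vi
          (row-loopless D (lighten-nonNeg P {γ} 0<1-γ) i)) sum≤t))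
        (false-row t (R i)))
      where
      vi : lighten P γ i ≡ 1ℚ
      vi = cong (if_then 1ℚ ℚ.- γ else 1ℚ) Pi

  single-true : ∀ {p i : Fin n} → single p i ≡ true → p ≡ i
  single-true {p = p} {i} eq with p Fin.≟ i
  single-true {p = p} {i} eq | yes p≡i = p≡i
  single-true {p = p} {i} () | no _

  insert-single-true : ∀ {p p′ i : Fin n} → insert p′ (single p) i ≡ true → p ≡ i ⊎ p′ ≡ i
  insert-single-true {p = p} {p′} {i} eq with p Fin.≟ i | p′ Fin.≟ i
  insert-single-true eq | yes p≡i | _        = inj₁ p≡i
  insert-single-true eq | no _    | yes p′≡i = inj₂ p′≡i
  insert-single-true () | no _    | no _

  lighten-single-≢ : ∀ {p q : Fin n} γ → p ≢ q → lighten (single p) γ q ≡ 1ℚ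
  lighten-single-≢ {p = p} {q} γ p≢q = cong (if_then 1ℚ ℚ.- γ else 1ℚ) (dec-false (p Fin.≟ q) p≢q)

  1-γ≤lighten : ∀ (P : Fin n → Bool) {γ} → 0ℚ ℚ.≤ γ → ∀ j → 1ℚ ℚ.- γ ℚ.≤ lighten P γ j
  1-γ≤lighten P {γ} 0≤γ j with P j
  ... | true  = ℚ.≤-refl
  ... | false = subst (1ℚ ℚ.- γ ℚ.≤_) (ℚ.+-identityʳ 1ℚ) (ℚ.+-monoʳ-≤ 1ℚ (ℚ.neg-antimono-≤ 0≤γ))

  1≤2 : 1ℚ ℚ.≤ ι 2
  1≤2 = 0≤⇒≤ 1ℚ (ℚ.<⇒≤ 0<1) refl

  moduli-≤-complete : ∀ {n} (D : Digraph n) → 3 ℕ.≤ n → ModuliBoundedBy D (fromℚ (ι n ℚ.- 1ℚ))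
  moduli-≤-complete {n} D 3≤n = moduli-≤ D (λ _ → false) {ι n} {0ℚ} (ι-mono 3≤n) ℚ.≤-refl
    (subst (ℚ._≤ ι 2) (sym (ℚ.*-zeroʳ (ι n))) (ι-nonNeg 2))
    (ℚ.≤-reflexive (sum-1 n)) (λ _ ())

module Deletion (n : ℕ) (4≤n : 4 ℕ.≤ n) where

  open Iteration (ι n) (ι-mono 4≤n) public

  opaque
    -- The missing target `q` has weight 1, which γ = 1/t matches exactly: tγ = 1.
    moduli-≤-deletion₁ : ∀ (D : Digraph n) {p q} → p ≢ q → arc D p q ≡ false → ∀ k →
      ModuliBoundedBy D (fromℚ (t k ℚ.- 1ℚ))
    moduli-≤-deletion₁ D {p} {q} p≢q pq k = moduli-≤ D (single p) {t k} {γ}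
      (3≤t k) (ℚ.<⇒≤ (0<e k)) tγ≤2
      (subst (ℚ._≤ t k) (sym (sum-lighten-single p γ)) (deletion₁ k)) light
      where
      γ : ℚ
      γ = e k
      tγ≤2 : t k ℚ.* γ ℚ.≤ ι 2
      tγ≤2 = subst (ℚ._≤ ι 2) (sym (t*e≡1 k)) 1≤2
      light : ∀ i → single p i ≡ true → Light D (single p) (t k) γ i
      light i pi = subst (Light D (single p) (t k) γ) (single-true {p = p} {i} pi) light-p
        where
        light-p : Light D (single p) (t k) γ p
        light-p = subst
          (λ x → rowSum (arc D p) (lighten (single p) γ) ℚ.+ lighten (single p) γ p ℚ.+ x ℚ.≤
            sum (lighten (single p) γ))
          (trans (lighten-single-≢ γ p≢q) (sym (t*e≡1 k)))
          (row-missing D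
            (lighten-nonNeg (single p) {γ} (1-γ>0 (3≤t k) (ℚ.<⇒≤ (0<e k)) tγ≤2)) p≢q pq)

    -- Two missing targets of weight 1 allow t′γ = 2 at the single light vertex.
    moduli-≤-deletion₂-common : ∀ (D : Digraph n) {p q q′} → p ≢ q → p ≢ q′ → q ≢ q′ →
      arc D p q ≡ false → arc D p q′ ≡ false → ModuliBoundedBy D (fromℚ (t′ ℚ.- 1ℚ))
    moduli-≤-deletion₂-common D {p} {q} {q′} p≢q p≢q′ q≢q′ pq pq′ =
      moduli-≤ D (single p) {t′} {γ} 3≤t′ 0≤γ (ℚ.≤-reflexive t′γ≡2)
        (subst (ℚ._≤ t′) (sym (sum-lighten-single p γ)) (deletion₂-common 0≤γ t′γ≡2)) light
      where
      0<t′ : 0ℚ ℚ.< t′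
      0<t′ = ℚ.<-≤-trans (ℚ.positive⁻¹ (ι 3)) 3≤t′
      b γ : ℚ
      b = proj₁ (inverse 0<t′)
      γ = b ℚ.+ b
      0≤γ : 0ℚ ℚ.≤ γ
      0≤γ = +-nonNeg (ℚ.<⇒≤ (proj₁ (proj₂ (inverse 0<t′)))) (ℚ.<⇒≤ (proj₁ (proj₂ (inverse 0<t′))))
      t′γ≡2 : t′ ℚ.* γ ≡ ι 2
      t′γ≡2 = trans (ℚ.*-distribˡ-+ t′ b b)
        (cong₂ ℚ._+_ (proj₂ (proj₂ (inverse 0<t′))) (proj₂ (proj₂ (inverse 0<t′))))
      light : ∀ i → single p i ≡ true → Light D (single p) t′ γ i
      light i pi = subst (Light D (single p) t′ γ) (single-true {p = p} {i} pi) light-p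
        where
        light-p : Light D (single p) t′ γ p
        light-p = subst (ℚ._≤ sum (lighten (single p) γ))
          (trans
            (ℚ.+-assoc (rowSum (arc D p) (lighten (single p) γ) ℚ.+ lighten (single p) γ p) _ _)
            (cong (λ x → rowSum (arc D p) (lighten (single p) γ) ℚ.+ lighten (single p) γ p ℚ.+ x)
              (trans (cong₂ ℚ._+_ (lighten-single-≢ γ p≢q) (lighten-single-≢ γ p≢q′)) (sym t′γ≡2))))
          (row-missing₂ D
            (lighten-nonNeg (single p) {γ} (1-γ>0 3≤t′ 0≤γ (ℚ.≤-reflexive t′γ≡2)))
            p≢q p≢q′ q≢q′ pq pq′)

    -- A missing target may be the other light vertex, so only weight 1 - γ is guaranteed for it.
    -- Hence t′γ = 1 - γ, that is γ = 1/(t′ + 1).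
    moduli-≤-deletion₂-distinct : ∀ (D : Digraph n) {p q p′ q′} → p ≢ p′ → p ≢ q → p′ ≢ q′ →
      arc D p q ≡ false → arc D p′ q′ ≡ false → ModuliBoundedBy D (fromℚ (t′ ℚ.- 1ℚ))
    moduli-≤-deletion₂-distinct D {p} {q} {p′} {q′} p≢p′ p≢q p′≢q′ pq p′q′ =
      moduli-≤ D P {t′} {γ} 3≤t′ 0≤γ t′γ≤2
        (subst (ℚ._≤ t′) (sym (sum-lighten-pair γ p≢p′)) (deletion₂-distinct 0≤γ [t′+1]γ≡1)) light
      where
      P : Fin n → Bool
      P = insert p′ (single p)
      0<t′+1 : 0ℚ ℚ.< t′ ℚ.+ 1ℚ
      0<t′+1 = ℚ.<-≤-trans (ℚ.positive⁻¹ (ι 3 ℚ.+ 1ℚ)) (ℚ.+-monoˡ-≤ 1ℚ 3≤t′)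
      γ : ℚ
      γ = proj₁ (inverse 0<t′+1)
      0≤γ : 0ℚ ℚ.≤ γ
      0≤γ = ℚ.<⇒≤ (proj₁ (proj₂ (inverse 0<t′+1)))
      [t′+1]γ≡1 : (t′ ℚ.+ 1ℚ) ℚ.* γ ≡ 1ℚ
      [t′+1]γ≡1 = proj₂ (proj₂ (inverse 0<t′+1))
      t′γ≡1-γ : t′ ℚ.* γ ≡ 1ℚ ℚ.- γ
      t′γ≡1-γ = trans (regroup t′ γ) (cong (ℚ._- γ) [t′+1]γ≡1)
        where
        regroup : ∀ t c → t ℚ.* c ≡ (t ℚ.+ 1ℚ) ℚ.* c ℚ.- c
        regroup = solve-∀ ℚ-ring
      t′γ≤2 : t′ ℚ.* γ ℚ.≤ ι 2
      t′γ≤2 = subst (ℚ._≤ ι 2) (sym t′γ≡1-γ)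
        (ℚ.≤-trans (1-γ≤lighten {n} (λ _ → false) {γ} 0≤γ p) 1≤2)
      v : Fin n → ℚ
      v = lighten P γ
      0≤v : ∀ j → 0ℚ ℚ.≤ v j
      0≤v = lighten-nonNeg P {γ} (1-γ>0 3≤t′ 0≤γ t′γ≤2)
      bound : ∀ {i j} → i ≢ j → arc D i j ≡ false → Light D P t′ γ i
      bound {i} {j} i≢j ij = ℚ.≤-trans
        (ℚ.+-monoʳ-≤ (rowSum (arc D i) v ℚ.+ v i)
          (subst (ℚ._≤ v j) (sym t′γ≡1-γ) (1-γ≤lighten P {γ} 0≤γ j)))
        (row-missing D 0≤v i≢j ij)
      light : ∀ i → P i ≡ true → Light D P t′ γ i
      light i Pi = [ (λ p≡i → subst (Light D P t′ γ) p≡i (bound {p} {q} p≢q pq))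
                   , (λ p′≡i → subst (Light D P t′ γ) p′≡i (bound {p′} {q′} p′≢q′ p′q′))
                   ]′ (insert-single-true {p = p} {p′} {i} Pi)

-- Order of the reals and real eigenvalues.

opaque
  nonNeg⇒0≤ : ∀ {x} → (∀ k → 0ℚ ℚ.≤ seq x k) → fromℕ 0 ≤ x
  nonNeg⇒0≤ {x} 0≤x (ε , 0<ε , N , h) =
    <⇒≱ (ℚ.<-≤-trans 0<ε (subst (ℚ._≤ seq x N ℚ.+ ε) (ℚ.+-identityˡ ε) (ℚ.+-monoˡ-≤ ε (0≤x N))))
      (h ℕ.≤-refl)

  -- Takes bounds at rational iterates to their limit. If `x` exceeded `r` by ε, it would exceed by
  -- ε/2 any term of `r` late enough to be within ε/2 of its successors.
  ≤-from-terms : ∀ {x} r → (∀ k → x ≤ fromℚ (seq r k)) → x ≤ r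
  ≤-from-terms {x} r x≤ (ε , 0<ε , N , h) with cauchy r (*-pos 0<½ 0<ε)
  ... | K , hK = x≤ (N ℕ.⊔ K) (½ ℚ.* ε , *-pos 0<½ 0<ε , N ℕ.⊔ K , λ {i} → late {i})
    where
    k : ℕ
    k = N ℕ.⊔ K
    regroup : ∀ a b e → ½ ℚ.* e ℚ.- (a ℚ.- b) ≡ (b ℚ.+ e) ℚ.- (a ℚ.+ ½ ℚ.* e)
    regroup = solve-∀ ℚ-ring
    late : ∀ {i} → k ℕ.≤ i → seq r k ℚ.+ ½ ℚ.* ε ℚ.≤ seq x i
    late {i} p = ℚ.≤-trans
      (0≤⇒≤ _ (≤⇒0≤ (ℚ.≤-trans (a≤∣a∣ (seq r k ℚ.- seq r i))
          (ℚ.<⇒≤ (hK (ℕ.m≤n⊔m N K) (ℕ.m⊔n≤o⇒n≤o N K p)))))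
        (regroup (seq r k) (seq r i) ε))
      (h (ℕ.m⊔n≤o⇒m≤o N K p))

  <⇒≄ : ∀ {x y} → x < y → ¬ x ≃ y
  <⇒≄ {x} {y} (ε , 0<ε , M , hM) x≃y with x≃y 0<ε
  ... | N , hN = <⇒≱ (hN {M ℕ.⊔ N} (ℕ.m≤n⊔m M N))
    (ℚ.≤-trans (0≤⇒≤ _ (≤⇒0≤ (hM (ℕ.m≤m⊔n M N))) (regroup (seq x k) (seq y k) ε))
      (subst (ℚ.- (seq x k ℚ.- seq y k) ℚ.≤_) (ℚ.∣-p∣≡∣p∣ (seq x k ℚ.- seq y k))
        (a≤∣a∣ (ℚ.- (seq x k ℚ.- seq y k)))))
    where
    k : ℕ
    k = M ℕ.⊔ N
    regroup : ∀ a b e → b ℚ.- (a ℚ.+ e) ≡ ℚ.- (a ℚ.- b) ℚ.- e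
    regroup = solve-∀ ℚ-ring

  -- The comparison at `N` is between rationals, hence decidable. A difference of at least 2δ there
  -- would stay at least δ from `N` on and prove `y < x`.
  close-term : ∀ {x y} N {δ} → x ≤ y → 0ℚ ℚ.< δ →
    (∀ {i} → N ℕ.≤ i → ∣ (seq x N ℚ.- seq y N) ℚ.- (seq x i ℚ.- seq y i) ∣ ℚ.< δ) →
    seq x N ℚ.- seq y N ℚ.< δ ℚ.+ δ
  close-term {x} {y} N {δ} x≤y 0<δ near with seq x N ℚ.- seq y N ℚ.<? δ ℚ.+ δ
  ... | yes p = p
  ... | no ¬p = contradiction (δ , 0<δ , N , λ {i} → apart {i}) x≤y
    where
    regroup : ∀ a b c d e → (((a ℚ.- b) ℚ.- (e ℚ.+ e)) ℚ.+ (e ℚ.- ((a ℚ.- b) ℚ.- (c ℚ.- d)))) ≡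
      c ℚ.- (d ℚ.+ e)
    regroup = solve-∀ ℚ-ring
    apart : ∀ {i} → N ℕ.≤ i → seq y i ℚ.+ δ ℚ.≤ seq x i
    apart {i} p = 0≤⇒≤ _
      (+-nonNeg (≤⇒0≤ (ℚ.≮⇒≥ ¬p))
        (≤⇒0≤ (ℚ.≤-trans (a≤∣a∣ ((seq x N ℚ.- seq y N) ℚ.- (seq x i ℚ.- seq y i)))
          (ℚ.<⇒≤ (near p)))))
      (regroup (seq x N) (seq y N) (seq x i) (seq y i) δ)

  -- `x ≤ y` is a negation and provides no index, so the index is taken from the Cauchy property of
  -- `x - y` with ε/3: two thirds bound the term at `N`, one third the drift after it.
  ≤⇒eventually-< : ∀ {x y} → x ≤ y → ∀ {ε} → 0ℚ ℚ.< ε →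
    ∃[ N ] (∀ {i} → N ℕ.≤ i → seq x i ℚ.- seq y i ℚ.< ε)
  ≤⇒eventually-< {x} {y} x≤y {ε} 0<ε with cauchy (x - y) (*-pos (ℚ.positive⁻¹ ⅓) 0<ε)
  ... | N , h = N , λ {i} p → 0<⇒< _
      (ℚ.+-mono-< (<⇒0<
          (close-term {x} {y} N x≤y (*-pos (ℚ.positive⁻¹ ⅓) 0<ε) (λ q → h ℕ.≤-refl q)))
        (<⇒0< (ℚ.≤-<-trans (a≤∣a∣ ((seq x i ℚ.- seq y i) ℚ.- (seq x N ℚ.- seq y N)))
          (h p ℕ.≤-refl))))
      (regroup ε (seq x N ℚ.- seq y N) (seq x i ℚ.- seq y i))
    where
    regroup : ∀ e a b → ((⅓ ℚ.* e ℚ.+ ⅓ ℚ.* e) ℚ.- a) ℚ.+ (⅓ ℚ.* e ℚ.- (b ℚ.- a)) ≡ e ℚ.- b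
    regroup = solve-∀ ℚ-ring

  ≤-antisym : ∀ {x y} → x ≤ y → y ≤ x → x ≃ y
  ≤-antisym {x} {y} x≤y y≤x {ε} 0<ε = proj₁ above ℕ.⊔ proj₁ below , λ {i} → close i
    where
    flip : ∀ a b → b ℚ.- a ≡ ℚ.- (a ℚ.- b)
    flip = solve-∀ ℚ-ring
    above : ∃[ N ] (∀ {i} → N ℕ.≤ i → seq x i ℚ.- seq y i ℚ.< ε)
    above = ≤⇒eventually-< {x} {y} x≤y 0<ε
    below : ∃[ N ] (∀ {i} → N ℕ.≤ i → seq y i ℚ.- seq x i ℚ.< ε)
    below = ≤⇒eventually-< {y} {x} y≤x 0<ε
    close : ∀ i → proj₁ above ℕ.⊔ proj₁ below ℕ.≤ i → ∣ seq x i ℚ.- seq y i ∣ ℚ.< ε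
    close i p = ∣∣<-intro {seq x i ℚ.- seq y i}
      (proj₂ above {i} (ℕ.m⊔n≤o⇒m≤o (proj₁ above) (proj₁ below) p))
      (subst (ℚ._< ε) (flip (seq x i) (seq y i))
        (proj₂ below {i} (ℕ.m⊔n≤o⇒n≤o (proj₁ above) (proj₁ below) p)))

  real-eigenvalue : ∀ (D : Digraph n) ρ (x : Fin n → ℝ) i₀ → (∀ k → 1ℚ ℚ.≤ seq (x i₀) k) →
    (∀ i → Null (λ k → rowSum (arc D i) (λ j → seq (x j) k) ℚ.- seq ρ k ℚ.* seq (x i) k)) →
    IsEigenvalue (adjacency D) (ρ +i fromℕ 0)
  real-eigenvalue {n} D ρ x i₀ 1≤x null = X , nonzero , λ i →
      null-ext (λ k → trans
          (cong (λ y → rowSum (arc D i) (λ j → seq (x j) k) ℚ.- y) (real (seq ρ k) (seq (x i) k)))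
          (cong (ℚ._- seq (re ((ρ +i fromℕ 0) *ℂ X i)) k) (sym (seq-re-· D X i k))))
        (null i)
    , null-0 (λ k → trans
          (cong₂ ℚ._-_ (trans (seq-im-· D X i k) (zero-sum i)) (imag (seq ρ k) (seq (x i) k)))
          (ℚ.+-inverseʳ 0ℚ))
    where
    X : Vector ℂ n
    X j = x j +i fromℕ 0
    nonzero : ¬ (∀ i → X i ≃ℂ 0ℂ)
    nonzero x≃0 with proj₁ (x≃0 i₀) 0<1
    ... | N , h = <⇒≱ (h ℕ.≤-refl)
      (ℚ.≤-trans (subst (1ℚ ℚ.≤_) (sym (ℚ.+-identityʳ (seq (x i₀) N))) (1≤x N))
        (a≤∣a∣ (seq (x i₀) N ℚ.- 0ℚ)))
    real : ∀ a b → a ℚ.* b ≡ a ℚ.* b ℚ.- 0ℚ ℚ.* 0ℚ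
    real = solve-∀ ℚ-ring
    imag : ∀ a b → a ℚ.* 0ℚ ℚ.+ 0ℚ ℚ.* b ≡ 0ℚ
    imag = solve-∀ ℚ-ring
    zero-sum : ∀ i → rowSum (arc D i) (λ _ → 0ℚ) ≡ 0ℚ
    zero-sum i = sum-zero λ j → Bool.if-eta (arc D i j)

  nonNeg-modulus : ∀ ρ → (∀ k → 0ℚ ℚ.≤ seq ρ k) → HasModulus (ρ +i fromℕ 0) ρ
  nonNeg-modulus ρ 0≤ρ = nonNeg⇒0≤ {ρ} 0≤ρ , null-0 (λ k → square (seq ρ k))
    where
    square : ∀ a → a ℚ.* a ℚ.- (a ℚ.* a ℚ.+ 0ℚ ℚ.* 0ℚ) ≡ 0ℚ
    square = solve-∀ ℚ-ring

  radius-≤ : ∀ {D : Digraph n} {r s} → HasSpectralRadius D r → ModuliBoundedBy D s → r ≤ s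
  radius-≤ {r = r} ((z , eig , mod) , _) bound = bound z r eig mod

  rowSum-but-one : ∀ (a : Fin n → Bool) f {i} → a i ≡ false → (∀ j → i ≢ j → a j ≡ true) →
    rowSum a f ℚ.+ f i ≡ sum f
  rowSum-but-one a f {i} ai full = trans (sym (rowSum-insert i a f ai)) (rowSum-full f insert-full)
    where
    insert-full : ∀ j → insert i a j ≡ true
    insert-full j with i Fin.≟ j
    ... | yes _  = Bool.∨-zeroʳ (a j)
    ... | no i≢j = trans (Bool.∨-identityʳ (a j)) (full j i≢j)

  sum-const : ∀ n c → sum {n} (λ _ → c) ≡ ι n ℚ.* c
  sum-const zero    c = sym (ℚ.*-zeroˡ c)
  sum-const (suc n) c = trans (cong (c ℚ.+_) (sum-const n c))
    (trans (regroup (ι n) c) (cong (ℚ._* c) (sym (ι-suc n))))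
    where
    regroup : ∀ x c → c ℚ.+ x ℚ.* c ≡ (1ℚ ℚ.+ x) ℚ.* c
    regroup = solve-∀ ℚ-ring

-- Classification by missing arcs, isomorphisms and connectivity.

IsComplete : Digraph n → Set
IsComplete D = ∀ i j → i ≢ j → arc D i j ≡ true

-- Two missing arcs are distinguished by their sources only, because the weights depend on nothing
-- else.
data Arcs (D : Digraph n) : Set where
  all-present : IsComplete D → Arcs D
  one-missing : ∀ p q → p ≢ q → arc D p q ≡ false →
    (∀ i j → i ≢ j → ¬ (i ≡ p × j ≡ q) → arc D i j ≡ true) → Arcs D
  two-missing-common : ∀ p q q′ → p ≢ q → p ≢ q′ → q ≢ q′ →
    arc D p q ≡ false → arc D p q′ ≡ false → Arcs D
  two-missing-distinct : ∀ p q p′ q′ → p ≢ p′ → p ≢ q → p′ ≢ q′ →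
    arc D p q ≡ false → arc D p′ q′ ≡ false → Arcs D

opaque
  ≢false⇒≡true : ∀ {b} → b ≢ false → b ≡ true
  ≢false⇒≡true {true}  _ = refl
  ≢false⇒≡true {false} h = contradiction refl h

  arcs : ∀ (D : Digraph n) → Arcs D
  arcs D with Fin.any? (λ i → Fin.any? λ j → ¬? (i Fin.≟ j) ×-dec (arc D i j Bool.≟ false))
  ... | no none = all-present λ i j i≢j → ≢false⇒≡true λ ij → none (i , j , i≢j , ij)
  ... | yes (p , q , p≢q , pq)
    with Fin.any? (λ i → Fin.any? λ j → ¬? (i Fin.≟ j) ×-dec
           (¬? ((i Fin.≟ p) ×-dec (j Fin.≟ q)) ×-dec (arc D i j Bool.≟ false)))
  ... | no none = one-missing p q p≢q pq λ i j i≢j other →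
    ≢false⇒≡true λ ij → none (i , j , i≢j , other , ij)
  ... | yes (p′ , q′ , p′≢q′ , other , p′q′) with p Fin.≟ p′
  ... | yes refl = two-missing-common p q q′ p≢q p′≢q′ (λ q≡q′ → other (refl , sym q≡q′)) pq p′q′
  ... | no p≢p′  = two-missing-distinct p q p′ q′ p≢p′ p≢q p′≢q′ pq p′q′

  complete-full : IsComplete (complete n)
  complete-full i j i≢j = cong not (dec-false (i Fin.≟ j) i≢j)

  IsComplete⇒≅ : ∀ {E : Digraph n} → IsComplete E → E ≅ complete n
  IsComplete⇒≅ {n} {E} full = Perm.id , same
    where
    same : ∀ i j → arc E i j ≡ arc (complete n) i j
    same i j with i Fin.≟ j
    ... | yes refl = loopless E i
    ... | no i≢j   = full i j i≢j

  complete-connected : StronglyConnected (complete n)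
  complete-connected i j with i Fin.≟ j
  ... | yes refl = Star.ε
  ... | no i≢j   = subst T (sym (complete-full i j i≢j)) tt ◅ Star.ε

  complete-eigenvalue : ∀ (D : Digraph (suc n)) → IsComplete D →
    IsEigenvalue (adjacency D) ((fromℕ (suc n) - fromℕ 1) +i fromℕ 0)
  complete-eigenvalue {n} D full = real-eigenvalue D (fromℕ (suc n) - fromℕ 1) (λ _ → fromℕ 1) zero
    (λ _ → ℚ.≤-refl)
    (λ i → null-0 λ _ → row i)
    where
    regroup : ∀ R N → R ℚ.- (N ℚ.- 1ℚ) ℚ.* 1ℚ ≡ (R ℚ.+ 1ℚ) ℚ.- N
    regroup = solve-∀ ℚ-ring
    row : ∀ i → rowSum (arc D i) (λ _ → 1ℚ) ℚ.- (ι (suc n) ℚ.- 1ℚ) ℚ.* 1ℚ ≡ 0ℚ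
    row i = trans (regroup (rowSum (arc D i) (λ _ → 1ℚ)) (ι (suc n)))
      (trans (cong (ℚ._- ι (suc n))
          (trans (rowSum-but-one (arc D i) (λ _ → 1ℚ) (loopless D i) (full i)) (sum-1 (suc n))))
        (ℚ.+-inverseʳ (ι (suc n))))

  complete-modulus : ∀ n →
    HasModulus ((fromℕ (suc n) - fromℕ 1) +i fromℕ 0) (fromℕ (suc n) - fromℕ 1)
  complete-modulus n = nonNeg-modulus (fromℕ (suc n) - fromℕ 1) λ _ →
    ≤⇒0≤ (ι-mono (ℕ.s≤s (ℕ.z≤n {n})))

  perm-injective : ∀ (π : Permutation′ n) {i j} → π ⟨$⟩ʳ i ≡ π ⟨$⟩ʳ j → i ≡ j
  perm-injective π eq = trans (sym (Perm.inverseˡ π)) (trans (cong (π ⟨$⟩ˡ_) eq) (Perm.inverseˡ π))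

  transpose-source : ∀ (i j : Fin n) → transpose i j ⟨$⟩ʳ i ≡ j
  transpose-source i j rewrite dec-true (i Fin.≟ i) refl = refl

  transpose-fix : ∀ {i j k : Fin n} → k ≢ i → k ≢ j → transpose i j ⟨$⟩ʳ k ≡ k
  transpose-fix {i = i} {j} {k} k≢i k≢j
    rewrite dec-false (k Fin.≟ i) k≢i | dec-false (k Fin.≟ j) k≢j = refl

  -- Move `p` to 0, then the image of `q` to 1. The second transposition fixes 0, since by
  -- injectivity the image of `q` is not 0.
  send-pair : ∀ {p q : Fin (suc (suc n))} → p ≢ q →
    Σ (Permutation′ (suc (suc n))) λ π → (π ⟨$⟩ʳ p ≡ zero × π ⟨$⟩ʳ q ≡ suc zero)
  send-pair {n} {p} {q} p≢q = π₁ ∘ₚ transpose q₁ (suc zero)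
    , trans (cong (transpose q₁ (suc zero) ⟨$⟩ʳ_) (transpose-source p zero))
        (transpose-fix
          (λ 0≡q₁ → p≢q (perm-injective π₁ (trans (transpose-source p zero) 0≡q₁))) λ ())
    , transpose-source q₁ (suc zero)
    where
    π₁ : Permutation′ (suc (suc n))
    π₁ = transpose p zero
    q₁ : Fin (suc (suc n))
    q₁ = π₁ ⟨$⟩ʳ q

opaque
  K-arc : ∀ {n} (i j : Fin (suc (suc n))) → i ≢ j → ¬ (i ≡ zero × j ≡ suc zero) →
    arc K[ suc (suc n) ,n-2,1] i j ≡ true
  K-arc i j i≢j other = cong₂ _∧_ (complete-full i j i≢j) (kept i j other)
    where
    kept : ∀ {n} (i j : Fin (suc (suc n))) → ¬ (i ≡ zero × j ≡ suc zero) →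
      not (does (toℕ i ℕ.≟ 0) ∧ does (toℕ j ℕ.≟ 1)) ≡ true
    kept zero    zero          _ = refl
    kept zero    (suc zero)    h = contradiction (refl , refl) h
    kept zero    (suc (suc j)) _ = refl
    kept (suc i) j             _ = refl

  K-connected : ∀ {n} → StronglyConnected K[ suc (suc (suc n)) ,n-2,1]
  K-connected i j with i Fin.≟ j | (i Fin.≟ zero) ×-dec (j Fin.≟ suc zero)
  ... | yes refl | _               = Star.ε
  -- The deleted arc is bypassed through vertex 2.
  ... | no _     | yes (refl , refl) = _◅_ {j = suc (suc zero)} tt (tt ◅ Star.ε)
  ... | no i≢j   | no other        = subst T (sym (K-arc i j i≢j other)) tt ◅ Star.ε

  one-missing⇒≅ : ∀ {n} {E : Digraph (suc (suc n))} p q → p ≢ q → arc E p q ≡ false →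
    (∀ i j → i ≢ j → ¬ (i ≡ p × j ≡ q) → arc E i j ≡ true) → E ≅ K[ suc (suc n) ,n-2,1]
  one-missing⇒≅ {n} {E} p q p≢q pq others = π , same
    where
    K : Digraph (suc (suc n))
    K = K[ suc (suc n) ,n-2,1]
    π : Permutation′ (suc (suc n))
    π = proj₁ (send-pair p≢q)
    πp : π ⟨$⟩ʳ p ≡ zero
    πp = proj₁ (proj₂ (send-pair p≢q))
    πq : π ⟨$⟩ʳ q ≡ suc zero
    πq = proj₂ (proj₂ (send-pair p≢q))
    same : ∀ i j → arc E i j ≡ arc K (π ⟨$⟩ʳ i) (π ⟨$⟩ʳ j)
    same i j with i Fin.≟ j | (i Fin.≟ p) ×-dec (j Fin.≟ q)
    ... | yes refl | _                 = trans (loopless E i) (sym (loopless K (π ⟨$⟩ʳ i)))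
    ... | no _     | yes (refl , refl) = trans pq (sym (cong₂ (arc K) πp πq))
    ... | no i≢j   | no other          = trans (others i j i≢j other)
      (sym (K-arc (π ⟨$⟩ʳ i) (π ⟨$⟩ʳ j) (λ eq → i≢j (perm-injective π eq))
        (λ (πi , πj) → other
          (perm-injective π (trans πi (sym πp)) , perm-injective π (trans πj (sym πq))))))

-- The second maximum and uniqueness.

module SecondMaximum (m : ℕ) where

  order : ℕ
  order = suc (suc (suc (suc m)))

  4≤n : 4 ℕ.≤ order
  4≤n = ℕ.s≤s (ℕ.s≤s (ℕ.s≤s (ℕ.s≤s ℕ.z≤n)))

  open Deletion order 4≤n

  K : Digraph order
  K = K[ order ,n-2,1]

  -- The roots of t² - n t + 1 sum to n, so their difference, the root of the discriminant, is 2t -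
  -- n. `ρ` has the closed form of the theorem, yet term by term it is `t k - 1ℚ`.
  T∞ √[n²-4] ρ : ℝ
  T∞ = mkℝ t t-cauchy
  √[n²-4] = fromℕ 2 * T∞ - fromℕ order
  ρ = fromℚ ½ * (fromℕ order - fromℕ 2 + √[n²-4])

  n-1 : ℝ
  n-1 = fromℕ order - fromℕ 1

  opaque
    seq-ρ : ∀ k → seq ρ k ≡ t k ℚ.- 1ℚ
    seq-ρ k = regroup (ι order) (t k)
      where
      regroup : ∀ N t → ½ ℚ.* ((N ℚ.- ι 2) ℚ.+ (ι 2 ℚ.* t ℚ.- N)) ≡ t ℚ.- 1ℚ
      regroup = solve-∀ ℚ-ring

    step-null : Null (λ k → t k ℚ.- t (suc k))
    step-null {ε} 0<ε = proj₁ (t-cauchy 0<ε) , λ {i} p →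
      proj₂ (t-cauchy 0<ε) {i} {suc i} p (ℕ.m≤n⇒m≤1+n p)

    √-isSqrt : IsSqrt (fromℕ order * fromℕ order - fromℕ 4) √[n²-4]
    √-isSqrt = nonNeg⇒0≤ {√[n²-4]} nonNeg
      , null-ext (λ k → sym (trans (square (ι order) (t k))
            (trans (cong (ι 4 ℚ.*_) (residual k)) (regroup (t k ℚ.- t (suc k)) (t k)))))
          (null-* step-null (fromℕ 4 * T∞))
      where
      square : ∀ N t → (ι 2 ℚ.* t ℚ.- N) ℚ.* (ι 2 ℚ.* t ℚ.- N) ℚ.- (N ℚ.* N ℚ.- ι 4) ≡
        ι 4 ℚ.* (t ℚ.* t ℚ.- N ℚ.* t ℚ.+ 1ℚ)
      square = solve-∀ ℚ-ring
      regroup : ∀ d t → ι 4 ℚ.* (d ℚ.* t) ≡ d ℚ.* (ι 4 ℚ.* t)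
      regroup = solve-∀ ℚ-ring
      split : ∀ N t → (t ℚ.- (N ℚ.- 1ℚ)) ℚ.+ (t ℚ.- 1ℚ) ≡ ι 2 ℚ.* t ℚ.- N
      split = solve-∀ ℚ-ring
      nonNeg : ∀ k → 0ℚ ℚ.≤ seq √[n²-4] k
      nonNeg k = subst (0ℚ ℚ.≤_) (split (ι order) (t k))
        (+-nonNeg (≤⇒0≤ (N-1≤t k)) (≤⇒0≤ (ℚ.≤-trans (ι-mono {1} {3} (ℕ.s≤s ℕ.z≤n)) (3≤t k))))

    -- The weights 1 - 1/t and 1 of the upper bound, scaled by t to clear the reciprocal; vertex 0
    -- is the source of the deleted arc.
    x : Fin order → ℝ
    x zero    = T∞ - fromℕ 1
    x (suc _) = T∞

    -- Every row of the eigenvalue equation reduces to t² − order t + 1 = 0.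
    K-eigenvalue : IsEigenvalue (adjacency K) (ρ +i fromℕ 0)
    K-eigenvalue = real-eigenvalue K ρ x (suc zero)
      (λ k → ℚ.≤-trans (ι-mono {1} {3} (ℕ.s≤s ℕ.z≤n)) (3≤t k))
      (λ i → null-ext (λ k → sym (row i k)) (null-* step-null (- T∞)))
      where
      v : ℕ → Fin order → ℚ
      v k j = seq (x j) k
      K₀₁ : arc K zero (suc zero) ≡ false
      K₀₁ = refl
      sum-v : ∀ k → sum (v k) ≡ ι order ℚ.* t k ℚ.- 1ℚ
      sum-v k = trans (cong (λ y → (t k ℚ.- 1ℚ) ℚ.+ y) (sum-const (suc (suc (suc m))) (t k)))
        (trans (regroup (ι (suc (suc (suc m)))) (t k))
          (cong (λ y → y ℚ.* t k ℚ.- 1ℚ) (sym (ι-suc (suc (suc (suc m)))))))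
        where
        regroup : ∀ N t → (t ℚ.- 1ℚ) ℚ.+ N ℚ.* t ≡ (1ℚ ℚ.+ N) ℚ.* t ℚ.- 1ℚ
        regroup = solve-∀ ℚ-ring
      first-row-full : ∀ j → zero ≢ j → insert (suc zero) (arc K zero) j ≡ true
      first-row-full zero          0≢0 = contradiction refl 0≢0
      first-row-full (suc zero)    _   = refl
      first-row-full (suc (suc j)) _   = refl
      first-row : ∀ k → (rowSum (arc K zero) (v k) ℚ.+ t k) ℚ.+ (t k ℚ.- 1ℚ) ≡ sum (v k)
      first-row k = trans
        (cong (ℚ._+ (t k ℚ.- 1ℚ)) (sym (rowSum-insert (suc zero) (arc K zero) (v k) K₀₁)))
        (rowSum-but-one (insert (suc zero) (arc K zero)) (v k) {zero} refl first-row-full)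
      other-row : ∀ i k → rowSum (arc K (suc i)) (v k) ℚ.+ t k ≡ sum (v k)
      other-row i k = rowSum-but-one (arc K (suc i)) (v k) (loopless K (suc i))
        (λ j i≢j → K-arc (suc i) j i≢j λ ())
      finish : ∀ {a b k} → a ≡ (sum (v k) ℚ.- t k ℚ.* t k) → a ≡ b →
        b ≡ (t k ℚ.- t (suc k)) ℚ.* (ℚ.- t k)
      finish {k = k} a≡ a≡b = trans (sym a≡b) (trans a≡
        (trans (cong (ℚ._- t k ℚ.* t k) (sum-v k))
          (trans (negate (ι order) (t k))
            (trans (cong ℚ.-_ (residual k)) (ℚ.neg-distribʳ-* (t k ℚ.- t (suc k)) (t k))))))
        where
        negate : ∀ N t → (N ℚ.* t ℚ.- 1ℚ) ℚ.- t ℚ.* t ≡ ℚ.- (t ℚ.* t ℚ.- N ℚ.* t ℚ.+ 1ℚ)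
        negate = solve-∀ ℚ-ring
      regroup₀ : ∀ R t → ((R ℚ.+ t) ℚ.+ (t ℚ.- 1ℚ)) ℚ.- t ℚ.* t ≡ R ℚ.- (t ℚ.- 1ℚ) ℚ.* (t ℚ.- 1ℚ)
      regroup₀ = solve-∀ ℚ-ring
      regroup₁ : ∀ R t → (R ℚ.+ t) ℚ.- t ℚ.* t ≡ R ℚ.- (t ℚ.- 1ℚ) ℚ.* t
      regroup₁ = solve-∀ ℚ-ring
      row : ∀ i k → rowSum (arc K i) (v k) ℚ.- seq ρ k ℚ.* v k i ≡ (t k ℚ.- t (suc k)) ℚ.* (ℚ.- t k)
      row zero k = finish {k = k} (cong (ℚ._- t k ℚ.* t k) (first-row k))
        (trans (regroup₀ (rowSum (arc K zero) (v k)) (t k))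
          (cong (λ y → rowSum (arc K zero) (v k) ℚ.- y ℚ.* (t k ℚ.- 1ℚ)) (sym (seq-ρ k))))
      row (suc i) k = finish {k = k} (cong (ℚ._- t k ℚ.* t k) (other-row i k))
        (trans (regroup₁ (rowSum (arc K (suc i)) (v k)) (t k))
          (cong (λ y → rowSum (arc K (suc i)) (v k) ℚ.- y ℚ.* t k) (sym (seq-ρ k))))

    ρ-modulus : HasModulus (ρ +i fromℕ 0) ρ
    ρ-modulus = nonNeg-modulus ρ λ k → subst (0ℚ ℚ.≤_) (sym (seq-ρ k))
      (≤⇒0≤ (ℚ.≤-trans (ι-mono {1} {3} (ℕ.s≤s ℕ.z≤n)) (3≤t k)))

    moduli-≤-ρ : ∀ (D : Digraph order) {p q} → p ≢ q → arc D p q ≡ false → ModuliBoundedBy D ρ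
    moduli-≤-ρ D p≢q pq z r eig mod = ≤-from-terms {r} ρ λ k →
      subst (λ y → r ≤ fromℚ y) (sym (seq-ρ k)) (moduli-≤-deletion₁ D p≢q pq k z r eig mod)

    K-radius : HasSpectralRadius K ρ
    K-radius = (ρ +i fromℕ 0 , K-eigenvalue , ρ-modulus)
      , moduli-≤-ρ K {zero} {suc zero} (λ ()) refl

    moduli-≤-n-1 : ∀ (D : Digraph order) → ModuliBoundedBy D n-1
    moduli-≤-n-1 D = moduli-≤-complete D (ℕ.m≤n⇒m≤1+n (ℕ.s≤s (ℕ.s≤s (ℕ.s≤s (ℕ.z≤n {m})))))

    IsComplete⇒radius : ∀ {D : Digraph order} → IsComplete D → HasSpectralRadius D n-1
    IsComplete⇒radius {D} full =
      (n-1 +i fromℕ 0 , complete-eigenvalue D full , complete-modulus (suc (suc (suc m))))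
      , moduli-≤-n-1 D

    IsComplete⇒n-1≤ : ∀ {D : Digraph order} {r} → IsComplete D → HasSpectralRadius D r → n-1 ≤ r
    IsComplete⇒n-1≤ {D} full (_ , largest) = largest (n-1 +i fromℕ 0) n-1
      (complete-eigenvalue D full) (complete-modulus (suc (suc (suc m))))

    ρ<n-1 : ρ < n-1
    -- `t 1` is n - `e 0` and later iterates are no larger. Index 0 has to be skipped, because `t 0`
    -- is n.
    ρ<n-1 = e 0 , 0<e 0 , 1 , λ {i} → late i
      where
      regroup : ∀ t₁ t e N → (t₁ ℚ.- t) ℚ.+ (N ℚ.- e ℚ.- t₁) ≡ (N ℚ.- 1ℚ) ℚ.- ((t ℚ.- 1ℚ) ℚ.+ e)
      regroup = solve-∀ ℚ-ring
      late : ∀ i → 1 ℕ.≤ i → seq ρ i ℚ.+ e 0 ℚ.≤ ι order ℚ.- 1ℚ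
      late (suc i) _ = subst (λ y → y ℚ.+ e 0 ℚ.≤ ι order ℚ.- 1ℚ) (sym (seq-ρ (suc i)))
        (0≤⇒≤ _
          (+-nonNeg (proj₁ (t-close 1 i)) (≤⇒0≤ (ℚ.≤-reflexive (t-suc 0))))
          (regroup (t 1) (t (suc i)) (e 0) (ι order)))

    t′-1<ρ : fromℚ (t′ ℚ.- 1ℚ) < ρ
    t′-1<ρ = f ℚ.* g , gap-pos , 0 , λ {i} _ → subst ((t′ ℚ.- 1ℚ) ℚ.+ f ℚ.* g ℚ.≤_) (sym (seq-ρ i))
      (0≤⇒≤ _ (≤⇒0≤ (t′+gap≤t i)) (regroup t′ (f ℚ.* g) (t i)))
      where
      regroup : ∀ s d t → t ℚ.- (s ℚ.+ d) ≡ (t ℚ.- 1ℚ) ℚ.- ((s ℚ.- 1ℚ) ℚ.+ d)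
      regroup = solve-∀ ℚ-ring

    complete-unique : ∀ (E : Digraph order) → StronglyConnected E → HasSpectralRadius E n-1 →
      E ≅ complete order
    complete-unique E _ radius = from-arcs (arcs E)
      where
      not-missing : ∀ {p q} → p ≢ q → arc E p q ≡ false → E ≅ complete order
      not-missing p≢q pq = contradiction ρ<n-1
        (radius-≤ {D = E} {n-1} {ρ} radius (moduli-≤-ρ E p≢q pq))
      from-arcs : Arcs E → E ≅ complete order
      from-arcs (all-present full) = IsComplete⇒≅ {E = E} full
      from-arcs (one-missing _ _ p≢q pq _) = not-missing p≢q pq
      from-arcs (two-missing-common _ _ _ p≢q _ _ pq _) = not-missing p≢q pq
      from-arcs (two-missing-distinct _ _ _ _ _ p≢q _ pq _) = not-missing p≢q pq

    K-unique : ∀ (E : Digraph order) → StronglyConnected E → HasSpectralRadius E ρ → E ≅ K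
    K-unique E _ radius = from-arcs (arcs E)
      where
      too-small : ModuliBoundedBy E (fromℚ (t′ ℚ.- 1ℚ)) → E ≅ K
      too-small bound = contradiction t′-1<ρ (radius-≤ {D = E} {ρ} {fromℚ (t′ ℚ.- 1ℚ)} radius bound)
      from-arcs : Arcs E → E ≅ K
      from-arcs (all-present full) = contradiction ρ<n-1 (IsComplete⇒n-1≤ {E} {ρ} full radius)
      from-arcs (one-missing p q p≢q pq others) = one-missing⇒≅ {E = E} p q p≢q pq others
      from-arcs (two-missing-common p q q′ p≢q p≢q′ q≢q′ pq pq′) =
        too-small (moduli-≤-deletion₂-common E p≢q p≢q′ q≢q′ pq pq′)
      from-arcs (two-missing-distinct p q p′ q′ p≢p′ p≢q p′≢q′ pq p′q′) =
        too-small (moduli-≤-deletion₂-distinct E p≢p′ p≢q p′≢q′ pq p′q′)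

    radius-≤-n-1 : ∀ r → SpectralRadii order r → r ≤ n-1
    radius-≤-n-1 r (E , _ , radius) = radius-≤ {D = E} {r} {n-1} radius (moduli-≤-n-1 E)

    n-1-maximum : IsMaximum (SpectralRadii order) n-1
    n-1-maximum = (complete order , complete-connected , IsComplete⇒radius {complete _} complete-full)
      , radius-≤-n-1

    ρ-second-maximum : IsSecondMaximum (SpectralRadii order) ρ
    ρ-second-maximum = n-1 , n-1-maximum
      , ((K , K-connected , K-radius) , <⇒≄ {ρ} {n-1} ρ<n-1)
      , λ r (spectral , r≄n-1) → below r spectral r≄n-1
      where
      below : ∀ r → SpectralRadii order r → ¬ r ≃ n-1 → r ≤ ρ
      below r spectral@(E , _ , radius) r≄n-1 = from-arcs (arcs E)
        where
        missing : ∀ {p q} → p ≢ q → arc E p q ≡ false → r ≤ ρ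
        missing p≢q pq = radius-≤ {D = E} {r} {ρ} radius (moduli-≤-ρ E p≢q pq)
        from-arcs : Arcs E → r ≤ ρ
        -- A spectral radius is fixed only up to `_≃_`, so `r` is identified with `n-1` by bounds on
        -- both sides.
        from-arcs (all-present full) = ⊥-elim (r≄n-1
          (λ {ε} → ≤-antisym {r} {n-1} (radius-≤-n-1 r spectral) (IsComplete⇒n-1≤ {E} {r} full radius) {ε}))
        from-arcs (one-missing _ _ p≢q pq _) = missing p≢q pq
        from-arcs (two-missing-common _ _ _ p≢q _ _ pq _) = missing p≢q pq
        from-arcs (two-missing-distinct _ _ _ _ _ p≢q _ pq _) = missing p≢q pq

theorem7p4 : ∀ (n : ℕ) → 4 ℕ.≤ n →
    (∃[ s ] IsSqrt (fromℕ n * fromℕ n - fromℕ 4) s ×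
    IsSecondMaximum (SpectralRadii n) (fromℚ ½ * (fromℕ n - fromℕ 2 + s)) ×
    IsUniqueWithSpectralRadius K[ n ,n-2,1] (fromℚ ½ * (fromℕ n - fromℕ 2 + s))) ×
    (IsMaximum (SpectralRadii n) (fromℕ n - fromℕ 1) ×
    IsUniqueWithSpectralRadius (complete n) (fromℕ n - fromℕ 1))
theorem7p4 _ (ℕ.s≤s (ℕ.s≤s (ℕ.s≤s (ℕ.s≤s (ℕ.z≤n {m}))))) =
    (√[n²-4] , √-isSqrt , ρ-second-maximum , K-connected , K-radius , K-unique)
  , n-1-maximum , complete-connected
  , IsComplete⇒radius {complete _} complete-full , complete-unique
  where
  open SecondMaximum m
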